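{- Let $\gamma \geq 0$ be an integer. The operad $\mathsf{Dendr}_\gamma$ admits the following presentation. It is generated by the set $\{\leftharpoonup_a, \rightharpoonup_a : a \in [\gamma]\}$ of binary generators and its space of relations is generated by $$\leftharpoonup_a \circ_1 \rightharpoonup_{a'} - \rightharpoonup_{a'} \circ_2 \leftharpoonup_a, \qquad a, a' \in [\gamma],$$ $$\leftharpoonup_a \circ_1 \leftharpoonup_b - \leftharpoonup_a \circ_2 \rightharpoonup_b, \qquad a < b \in [\gamma],$$ $$\rightharpoonup_a \circ_1 \leftharpoonup_b - \rightharpoonup_a \circ_2 \rightharpoonup_b, \qquad a < b \in [\gamma],$$ $$\leftharpoonup_b \circ_1 \leftharpoonup_a - \leftharpoonup_a \circ_2 \leftharpoonup_b, \qquad a < b \in [\gamma],$$ $$\rightharpoonup_a \circ_1 \rightharpoonup_b - \rightharpoonup_b \circ_2 \rightharpoonup_a, \qquad a < b \in [\gamma],$$ $$\leftharpoonup_d \circ_1 \leftharpoonup_d - \Big(\sum_{c \in [d]} \leftharpoonup_d \circ_2 \leftharpoonup_c + \leftharpoonup_d \circ_2 \rightharpoonup_c\Big), \qquad d \in [\gamma],$$ $$\Big(\sum_{c \in [d]} \rightharpoonup_d \circ_1 \rightharpoonup_c + \rightharpoonup_d \circ_1 \leftharpoonup_c\Big) - \rightharpoonup_d \circ_2 \rightharpoonup_d, \qquad d \in [\gamma].$$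
   Context: The ground field $\mathbb{K}$ has characteristic zero; operad means nonsymmetric operad; $[n] = \{1, \dots, n\}$; $a \uparrow a' := \max(a, a')$. $\mathbf{Free}(\mathfrak{G})$ is the free operad on a set $\mathfrak{G}$ of binary generators (spanned by planar binary trees with internal nodes labeled by $\mathfrak{G}$); $(\mathfrak{G}, \mathfrak{R})$ is a presentation of $\mathcal{O}$ if $\mathcal{O} \cong \mathbf{Free}(\mathfrak{G})/\langle \mathfrak{R} \rangle$, with $\langle \mathfrak{R} \rangle$ the operad ideal generated by the subspace $\mathfrak{R}$. Koszul dual: if $\mathcal{O}$ has a presentation $(\mathfrak{G}, \mathfrak{R})$ with $\mathfrak{G}$ in arity $2$ and $\mathfrak{R} \subseteq \mathbf{Free}(\mathfrak{G})(3)$, its Koszul dual is the operad with presentation $(\mathfrak{G}, \mathfrak{R}^\perp)$, where $\mathfrak{R}^\perp$ is the annihilator of $\mathfrak{R}$ in $\mathbf{Free}(\mathfrak{G})(3)$ for the bilinear form with $\langle x \circ_i y, x' \circ_{i'} y' \rangle = 1$ if $x = x', y = y', i = i' = 1$; $= -1$ if $x = x', y = y', i = i' = 2$; and $0$ otherwise ($x, x', y, y' \in \mathfrak{G}$). $\mathsf{Dias}_\gamma$ is the operad whose arity-$n$ component is spanned by the words of length $n$ on $\{0\} \cup [\gamma]$ with exactly one $0$, with $u \circ_i v := u_1 \dots u_{i-1} \max(u_i, v_1) \dots \max(u_i, v_m) u_{i+1} \dots u_n$. It is presented by generators $\dashv_a, \vdash_a$, $a \in [\gamma]$ (standing for the words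 $0a$ and $a0$) and the space of relations spanned, for all $a, a' \in [\gamma]$, by $\dashv_a \circ_1 \vdash_{a'} - \vdash_{a'} \circ_2 \dashv_a$; $\dashv_a \circ_1 \dashv_{a \uparrow a'} - \dashv_a \circ_2 \vdash_{a'}$; $\vdash_a \circ_1 \dashv_{a'} - \vdash_a \circ_2 \vdash_{a \uparrow a'}$; $\dashv_{a \uparrow a'} \circ_1 \dashv_a - \dashv_a \circ_2 \dashv_{a'}$; $\vdash_a \circ_1 \vdash_{a'} - \vdash_{a \uparrow a'} \circ_2 \vdash_a$. $\mathsf{Dendr}_\gamma$ is the Koszul dual of $\mathsf{Dias}_\gamma$. -}

module Defs where

open import Level using (Level; _⊔_) renaming (suc to lsuc)
open import Algebra.Apartness.Bundles using (HeytingField; HeytingCommutativeRing)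
open import Algebra.Bundles using (CommutativeRing)
open import Algebra.Module.Bundles using (LeftModule)
open import Algebra.Module.Morphism.Structures using (module LeftModuleMorphisms)
import Algebra.Module.Construct.TensorUnit as TensorUnit
import Algebra.Definitions.RawMonoid as RawMonoidOps
import Algebra.Properties.AbelianGroup as AbelianGroupProperties
open import Data.Bool using (if_then_else_; _∧_)
open import Data.Fin using (Fin; zero; suc; toℕ; fromℕ; _<_; _≤?_)
import Data.Fin.Properties as Fin
open import Data.List using (List; []; _∷_; _++_; map; foldr; filter; length; allFin)
open import Data.List.Properties
  using (++-assoc; ++-identityʳ; length-++; length-map; map-++; map-∘; map-cong; map-id; filter-++)
open import Data.Nat as ℕ using (ℕ; zero; suc; _+_; _∸_)
import Data.Nat.Properties as ℕ
open import Data.Product using (Σ; _,_; proj₁; proj₂)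
open import Data.Empty using (⊥-elim)
open import Relation.Binary.Core using (Rel)
open import Relation.Binary.Definitions using (DecidableEquality)
open import Relation.Binary.PropositionalEquality as ≡ using (_≡_; refl; cong; cong₂; subst)
open import Relation.Nullary using (¬_; yes; no; does)
open import Relation.Nullary.Decidable using (map′)
open import Relation.Unary using (Pred)
import Relation.Binary.Reasoning.Setoid as SetoidReasoning

private
  variable
    c ℓ₁ ℓ₂ : Level

CharacteristicZero : HeytingField c ℓ₁ ℓ₂ → Set ℓ₁
CharacteristicZero K = ∀ n → ¬ (suc n × 1# ≈ 0#)
  where
  open HeytingCommutativeRing (HeytingField.heytingCommutativeRing K) using (commutativeRing)
  open CommutativeRing commutativeRing using (_≈_; 0#; 1#; +-rawMonoid)
  open RawMonoidOps +-rawMonoid using (_×_)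

-- Operads in sets, with a single carrier graded by arity.  Inputs are numbered from 0;
-- the value of  graft x i y  is irrelevant unless i < arity x.
record SetOperad (b : Level) : Set (lsuc b) where
  field
    Elem        : Set b
    arity       : Elem → ℕ
    unit        : Elem
    graft       : Elem → ℕ → Elem → Elem
    arity-unit  : arity unit ≡ 1
    arity-graft : ∀ x i y → i ℕ.< arity x → suc (arity (graft x i y)) ≡ arity x + arity y
    identityˡ   : ∀ x → graft unit 0 x ≡ x
    identityʳ   : ∀ x i → i ℕ.< arity x → graft x i unit ≡ x
    sequential  : ∀ x i y j z → i ℕ.< arity x → j ℕ.< arity y →
                  graft (graft x i y) (i + j) z ≡ graft x i (graft y j z)
    parallel    : ∀ x i j y z l → i ℕ.< j → j ℕ.< arity x → suc l ≡ j + arity y →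
                  graft (graft x i y) l z ≡ graft (graft x j z) i y

data Tree {g : Level} (G : Set g) : Set g where
  leaf : Tree G
  node : G → Tree G → Tree G → Tree G

module Trees {g : Level} (G : Set g) where

  leaves : Tree G → ℕ
  leaves leaf         = 1
  leaves (node _ l r) = leaves l + leaves r

  graft : Tree G → ℕ → Tree G → Tree G
  graft leaf         _ s = s
  graft (node x l r) i s with i ℕ.<? leaves l
  ... | yes _ = node x (graft l i s) r
  ... | no  _ = node x l (graft r (i ∸ leaves l) s)

  graft-left : ∀ x l r i s → i ℕ.< leaves l → graft (node x l r) i s ≡ node x (graft l i s) r
  graft-left x l r i s i<l with i ℕ.<? leaves l
  ... | yes _   = refl
  ... | no  i≮l = ⊥-elim (i≮l i<l)

  graft-right : ∀ x l r i s → graft (node x l r) (leaves l + i) s ≡ node x l (graft r i s)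
  graft-right x l r i s with leaves l + i ℕ.<? leaves l
  ... | yes p = ⊥-elim (ℕ.m+n≮m (leaves l) i p)
  ... | no  _ = cong (λ k → node x l (graft r k s)) (ℕ.m+n∸m≡n (leaves l) i)

  graft-right′ : ∀ x l r i s j → j ≡ leaves l + i → graft (node x l r) j s ≡ node x l (graft r i s)
  graft-right′ x l r i s _ refl = graft-right x l r i s

  data Side (l r : Tree G) : ℕ → Set where
    left  : ∀ {i} → i ℕ.< leaves l → Side l r i
    right : ∀ i → i ℕ.< leaves r → Side l r (leaves l + i)

  side : ∀ l r i → i ℕ.< leaves l + leaves r → Side l r i
  side l r i i<n with i ℕ.<? leaves l
  ... | yes i<l = left i<l
  ... | no  i≮l = subst (Side l r) (ℕ.m+[n∸m]≡n (ℕ.≮⇒≥ i≮l))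
                    (right (i ∸ leaves l)
                      (ℕ.+-cancelˡ-< (leaves l) _ _
                        (subst (ℕ._< leaves l + leaves r) (≡.sym (ℕ.m+[n∸m]≡n (ℕ.≮⇒≥ i≮l))) i<n)))

  leaves-graft : ∀ t i s → i ℕ.< leaves t → suc (leaves (graft t i s)) ≡ leaves t + leaves s
  leaves-graft leaf         i s _ = refl
  leaves-graft (node x l r) i s i<n with side l r i i<n
  ... | left i<l rewrite graft-left x l r i s i<l = begin
    suc (leaves (graft l i s)) + leaves r ≡⟨ cong (_+ leaves r) (leaves-graft l i s i<l) ⟩
    leaves l + leaves s + leaves r        ≡⟨ ℕ.+-assoc (leaves l) _ _ ⟩
    leaves l + (leaves s + leaves r)      ≡⟨ cong (leaves l +_) (ℕ.+-comm (leaves s) _) ⟩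
    leaves l + (leaves r + leaves s)      ≡⟨ ℕ.+-assoc (leaves l) _ _ ⟨
    leaves l + leaves r + leaves s        ∎
    where open ≡.≡-Reasoning
  ... | right j j<r rewrite graft-right x l r j s = begin
    suc (leaves l + leaves (graft r j s)) ≡⟨ ℕ.+-suc (leaves l) _ ⟨
    leaves l + suc (leaves (graft r j s)) ≡⟨ cong (leaves l +_) (leaves-graft r j s j<r) ⟩
    leaves l + (leaves r + leaves s)      ≡⟨ ℕ.+-assoc (leaves l) _ _ ⟨
    leaves l + leaves r + leaves s        ∎
    where open ≡.≡-Reasoning

  graft-identityʳ : ∀ t i → i ℕ.< leaves t → graft t i leaf ≡ t
  graft-identityʳ leaf         i _ = refl
  graft-identityʳ (node x l r) i i<n with side l r i i<n
  ... | left i<l    rewrite graft-left x l r i leaf i<l = cong (λ l′ → node x l′ r) (graft-identityʳ l i i<l)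
  ... | right j j<r rewrite graft-right x l r j leaf    = cong (node x l) (graft-identityʳ r j j<r)

  in-graft : ∀ t i s j → i ℕ.< leaves t → j ℕ.< leaves s → i + j ℕ.< leaves (graft t i s)
  in-graft t i s j i<t j<s = ℕ.s<s⁻¹ (begin-strict
    suc (i + j)                ≡⟨⟩
    suc i + j                  ≤⟨ ℕ.+-monoˡ-≤ j i<t ⟩
    leaves t + j               <⟨ ℕ.+-monoʳ-< (leaves t) j<s ⟩
    leaves t + leaves s        ≡⟨ leaves-graft t i s i<t ⟨
    suc (leaves (graft t i s)) ∎)
    where open ℕ.≤-Reasoning

  graft-sequential : ∀ t i s j u → i ℕ.< leaves t → j ℕ.< leaves s →
                     graft (graft t i s) (i + j) u ≡ graft t i (graft s j u)
  graft-sequential leaf         zero s j u _ _ = refl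
  graft-sequential leaf         (suc i) s j u (ℕ.s≤s ()) _
  graft-sequential (node x l r) i s j u i<n j<s with side l r i i<n
  ... | left i<l rewrite graft-left x l r i s i<l
                       | graft-left x l r i (graft s j u) i<l
                       | graft-left x (graft l i s) r (i + j) u (in-graft l i s j i<l j<s)
                       = cong (λ l′ → node x l′ r) (graft-sequential l i s j u i<l j<s)
  ... | right k k<r rewrite graft-right x l r k s
                          | graft-right x l r k (graft s j u)
                          | ℕ.+-assoc (leaves l) k j
                          | graft-right x l (graft r k s) (k + j) u
                          = cong (node x l) (graft-sequential r k s j u k<r j<s)

  graft-parallel : ∀ t i j s u k → i ℕ.< j → j ℕ.< leaves t → suc k ≡ j + leaves s →
                   graft (graft t i s) k u ≡ graft (graft t j u) i s
  graft-parallel leaf i .0 s u k () (ℕ.s≤s ℕ.z≤n) _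
  graft-parallel (node x l r) i j s u k i<j j<n k≡ with side l r j j<n
  ... | left j<l = begin
    graft (graft (node x l r) i s) k u ≡⟨ cong (λ t → graft t k u) (graft-left x l r i s i<l) ⟩
    graft (node x (graft l i s) r) k u ≡⟨ graft-left x (graft l i s) r k u k< ⟩
    node x (graft (graft l i s) k u) r ≡⟨ cong (λ t → node x t r) (graft-parallel l i j s u k i<j j<l k≡) ⟩
    node x (graft (graft l j u) i s) r ≡⟨ graft-left x (graft l j u) r i s i< ⟨
    graft (node x (graft l j u) r) i s ≡⟨ cong (λ t → graft t i s) (graft-left x l r j u j<l) ⟨
    graft (graft (node x l r) j u) i s ∎
    where
    open ≡.≡-Reasoning
    i<l : i ℕ.< leaves l
    i<l = ℕ.<-trans i<j j<l
    k< : k ℕ.< leaves (graft l i s)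
    k< = ℕ.s<s⁻¹ (≡.subst₂ ℕ._<_ (≡.sym k≡) (≡.sym (leaves-graft l i s i<l))
           (ℕ.+-monoˡ-< (leaves s) j<l))
    i< : i ℕ.< leaves (graft l j u)
    i< = ℕ.s<s⁻¹ (subst (suc i ℕ.<_) (≡.sym (leaves-graft l j u j<l))
           (ℕ.≤-<-trans i<j (ℕ.<-≤-trans j<l (ℕ.m≤m+n _ _))))
  ... | right j′ j′<r with side l r i (ℕ.<-trans i<j j<n)
  ...   | left i<l = begin
    graft (graft (node x l r) i s) k u     ≡⟨ cong (λ t → graft t k u) (graft-left x l r i s i<l) ⟩
    graft (node x (graft l i s) r) k u     ≡⟨ graft-right′ x (graft l i s) r j′ u k (ℕ.suc-injective k≡′) ⟩
    node x (graft l i s) (graft r j′ u)    ≡⟨ graft-left x l (graft r j′ u) i s i<l ⟨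
    graft (node x l (graft r j′ u)) i s    ≡⟨ cong (λ t → graft t i s) (graft-right x l r j′ u) ⟨
    graft (graft (node x l r) (leaves l + j′) u) i s ∎
    where
    open ≡.≡-Reasoning
    k≡′ : suc k ≡ suc (leaves (graft l i s) + j′)
    k≡′ = begin
      suc k                                 ≡⟨ k≡ ⟩
      leaves l + j′ + leaves s              ≡⟨ ℕ.+-assoc (leaves l) _ _ ⟩
      leaves l + (j′ + leaves s)            ≡⟨ cong (leaves l +_) (ℕ.+-comm j′ _) ⟩
      leaves l + (leaves s + j′)            ≡⟨ ℕ.+-assoc (leaves l) _ _ ⟨
      leaves l + leaves s + j′              ≡⟨ cong (_+ j′) (leaves-graft l i s i<l) ⟨
      suc (leaves (graft l i s) + j′)       ∎
  ...   | right i′ i′<r = begin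
    graft (graft (node x l r) (leaves l + i′) s) k u ≡⟨ cong (λ t → graft t k u) (graft-right x l r i′ s) ⟩
    graft (node x l (graft r i′ s)) k u              ≡⟨ graft-right′ x l (graft r i′ s) k′ u k (≡.sym (ℕ.m+[n∸m]≡n l≤k)) ⟩
    node x l (graft (graft r i′ s) k′ u)             ≡⟨ cong (node x l) (graft-parallel r i′ j′ s u k′ i′<j′ j′<r k′≡) ⟩
    node x l (graft (graft r j′ u) i′ s)             ≡⟨ graft-right x l (graft r j′ u) i′ s ⟨
    graft (node x l (graft r j′ u)) (leaves l + i′) s ≡⟨ cong (λ t → graft t (leaves l + i′) s) (graft-right x l r j′ u) ⟨
    graft (graft (node x l r) (leaves l + j′) u) (leaves l + i′) s ∎
    where
    open ≡.≡-Reasoning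
    k′ : ℕ
    k′ = k ∸ leaves l
    i′<j′ : i′ ℕ.< j′
    i′<j′ = ℕ.+-cancelˡ-< (leaves l) _ _ i<j
    k≡₂ : suc k ≡ leaves l + (j′ + leaves s)
    k≡₂ = ≡.trans k≡ (ℕ.+-assoc (leaves l) j′ (leaves s))
    l≤k : leaves l ℕ.≤ k
    l≤k = ℕ.s≤s⁻¹ (subst (suc (leaves l) ℕ.≤_) (≡.sym k≡₂)
            (subst (ℕ._≤ leaves l + (j′ + leaves s)) (ℕ.+-comm (leaves l) 1)
              (ℕ.+-monoʳ-≤ (leaves l)
                (ℕ.≤-trans (ℕ.≤-trans (ℕ.s≤s ℕ.z≤n) i′<j′) (ℕ.m≤m+n j′ _)))))
    k′≡ : suc k′ ≡ j′ + leaves s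
    k′≡ = ℕ.+-cancelˡ-≡ (leaves l) _ _
            (≡.trans (ℕ.+-suc (leaves l) _)
              (≡.trans (cong suc (ℕ.m+[n∸m]≡n l≤k)) k≡₂))

  setOperad : SetOperad g
  setOperad = record
    { Elem        = Tree G
    ; arity       = leaves
    ; unit        = leaf
    ; graft       = graft
    ; arity-unit  = refl
    ; arity-graft = leaves-graft
    ; identityˡ   = λ _ → refl
    ; identityʳ   = graft-identityʳ
    ; sequential  = graft-sequential
    ; parallel    = graft-parallel
    }

infixr 6 _↑_
_↑_ : ∀ {n} → Fin n → Fin n → Fin n
zero  ↑ b     = b
suc a ↑ zero  = suc a
suc a ↑ suc b = suc (a ↑ b)

↑-identityʳ : ∀ {n} (a : Fin (suc n)) → a ↑ zero ≡ a
↑-identityʳ zero    = refl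
↑-identityʳ (suc a) = refl

↑-assoc : ∀ {n} (a b d : Fin n) → (a ↑ b) ↑ d ≡ a ↑ b ↑ d
↑-assoc zero    b       d       = refl
↑-assoc (suc a) zero    d       = refl
↑-assoc (suc a) (suc b) zero    = refl
↑-assoc (suc a) (suc b) (suc d) = cong suc (↑-assoc a b d)

↑-comm : ∀ {n} (a b : Fin n) → a ↑ b ≡ b ↑ a
↑-comm zero    zero    = refl
↑-comm zero    (suc b) = refl
↑-comm (suc a) zero    = refl
↑-comm (suc a) (suc b) = cong suc (↑-comm a b)

↑-idem : ∀ {n} (a : Fin n) → a ↑ a ≡ a
↑-idem zero    = refl
↑-idem (suc a) = cong suc (↑-idem a)

-- The set [γ] is encoded by Fin γ, and the alphabet {0} ∪ [γ] by Fin (suc γ), in which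
-- suc a  is the letter a ∈ [γ].
module Words (γ : ℕ) where

  Letter : Set
  Letter = Fin (suc γ)

  zeros : List Letter → ℕ
  zeros w = length (filter (Fin._≟ zero) w)

  Word : Set
  Word = Σ (List Letter) λ w → zeros w ≡ 1

  substitute : List Letter → ℕ → List Letter → List Letter
  substitute []      _       _ = []
  substitute (a ∷ u) zero    v = map (a ↑_) v ++ u
  substitute (a ∷ u) (suc i) v = a ∷ substitute u i v

  zeros-++ : ∀ u v → zeros (u ++ v) ≡ zeros u + zeros v
  zeros-++ u v = ≡.trans (cong length (filter-++ (Fin._≟ zero) u v)) (length-++ (filter (Fin._≟ zero) u))

  map-0↑ : (w : List Letter) → map (zero ↑_) w ≡ w
  map-0↑ = map-id

  zeros-↑ : ∀ (a : Fin γ) w → zeros (map (suc a ↑_) w) ≡ 0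
  zeros-↑ a []          = refl
  zeros-↑ a (zero  ∷ w) = zeros-↑ a w
  zeros-↑ a (suc b ∷ w) = zeros-↑ a w

  zeros-substitute : ∀ u i v → zeros v ≡ 1 → i ℕ.< length u → zeros (substitute u i v) ≡ zeros u
  zeros-substitute (zero ∷ u) zero v v1 _ = begin
    zeros (map (zero ↑_) v ++ u) ≡⟨ cong (λ v′ → zeros (v′ ++ u)) (map-0↑ v) ⟩
    zeros (v ++ u)               ≡⟨ zeros-++ v u ⟩
    zeros v + zeros u            ≡⟨ cong (_+ zeros u) v1 ⟩
    suc (zeros u)                ∎
    where open ≡.≡-Reasoning
  zeros-substitute (suc a ∷ u) zero v v1 _ =
    ≡.trans (zeros-++ (map (suc a ↑_) v) u) (cong (_+ zeros u) (zeros-↑ a v))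
  zeros-substitute (zero ∷ u) (suc i) v v1 (ℕ.s≤s i<n) = cong suc (zeros-substitute u i v v1 i<n)
  zeros-substitute (suc a ∷ u) (suc i) v v1 (ℕ.s≤s i<n) = zeros-substitute u i v v1 i<n

  length-substitute : ∀ u i v → i ℕ.< length u → suc (length (substitute u i v)) ≡ length u + length v
  length-substitute (a ∷ u) zero v _ = cong suc (begin
    length (map (a ↑_) v ++ u)        ≡⟨ length-++ (map (a ↑_) v) ⟩
    length (map (a ↑_) v) + length u  ≡⟨ cong (_+ length u) (length-map (a ↑_) v) ⟩
    length v + length u               ≡⟨ ℕ.+-comm (length v) _ ⟩
    length u + length v               ∎)
    where open ≡.≡-Reasoning
  length-substitute (a ∷ u) (suc i) v (ℕ.s≤s i<n) = cong suc (length-substitute u i v i<n)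

  substitute-identityʳ : ∀ u i → substitute u i (zero ∷ []) ≡ u
  substitute-identityʳ []      i       = refl
  substitute-identityʳ (a ∷ u) zero    = cong (_∷ u) (↑-identityʳ a)
  substitute-identityʳ (a ∷ u) (suc i) = cong (a ∷_) (substitute-identityʳ u i)

  substitute-++ˡ : ∀ u v i w → i ℕ.< length u → substitute (u ++ v) i w ≡ substitute u i w ++ v
  substitute-++ˡ (a ∷ u) v zero    w _           = ≡.sym (++-assoc (map (a ↑_) w) u v)
  substitute-++ˡ (a ∷ u) v (suc i) w (ℕ.s≤s i<n) = cong (a ∷_) (substitute-++ˡ u v i w i<n)

  substitute-++ʳ : ∀ u v i w → substitute (u ++ v) (length u + i) w ≡ u ++ substitute v i w
  substitute-++ʳ []      v i w = refl
  substitute-++ʳ (a ∷ u) v i w = cong (a ∷_) (substitute-++ʳ u v i w)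

  map-↑-↑ : ∀ (a b : Letter) w → map ((a ↑ b) ↑_) w ≡ map (a ↑_) (map (b ↑_) w)
  map-↑-↑ a b w = ≡.trans (map-cong (↑-assoc a b) w) (map-∘ w)

  substitute-map : ∀ a u i w → substitute (map (a ↑_) u) i w ≡ map (a ↑_) (substitute u i w)
  substitute-map a []      i       w = refl
  substitute-map a (b ∷ u) (suc i) w = cong (a ↑ b ∷_) (substitute-map a u i w)
  substitute-map a (b ∷ u) zero    w = begin
    map ((a ↑ b) ↑_) w ++ map (a ↑_) u        ≡⟨ cong (_++ map (a ↑_) u) (map-↑-↑ a b w) ⟩
    map (a ↑_) (map (b ↑_) w) ++ map (a ↑_) u ≡⟨ map-++ (a ↑_) (map (b ↑_) w) u ⟨
    map (a ↑_) (map (b ↑_) w ++ u)            ∎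
    where open ≡.≡-Reasoning

  substitute-sequential : ∀ u i v j w → i ℕ.< length u → j ℕ.< length v →
                          substitute (substitute u i v) (i + j) w ≡ substitute u i (substitute v j w)
  substitute-sequential (a ∷ u) (suc i) v j w (ℕ.s≤s i<n) j<m =
    cong (a ∷_) (substitute-sequential u i v j w i<n j<m)
  substitute-sequential (a ∷ u) zero    v j w _ j<m = begin
    substitute (map (a ↑_) v ++ u) j w  ≡⟨ substitute-++ˡ (map (a ↑_) v) u j w
                                             (subst (j ℕ.<_) (≡.sym (length-map (a ↑_) v)) j<m) ⟩
    substitute (map (a ↑_) v) j w ++ u  ≡⟨ cong (_++ u) (substitute-map a v j w) ⟩
    map (a ↑_) (substitute v j w) ++ u  ∎
    where open ≡.≡-Reasoning

  substitute-parallel : ∀ u i j v w l → i ℕ.< j → j ℕ.< length u → suc l ≡ j + length v →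
                        substitute (substitute u i v) l w ≡ substitute (substitute u j w) i v
  substitute-parallel (a ∷ u) zero (suc j) v w l _ _ l≡ = begin
    substitute (map (a ↑_) v ++ u) l w                          ≡⟨ cong (λ k → substitute (map (a ↑_) v ++ u) k w) l≡′ ⟩
    substitute (map (a ↑_) v ++ u) (length (map (a ↑_) v) + j) w ≡⟨ substitute-++ʳ (map (a ↑_) v) u j w ⟩
    map (a ↑_) v ++ substitute u j w                            ∎
    where
    open ≡.≡-Reasoning
    l≡′ : l ≡ length (map (a ↑_) v) + j
    l≡′ = ≡.trans (ℕ.suc-injective l≡)
            (≡.trans (ℕ.+-comm j _) (cong (_+ j) (≡.sym (length-map (a ↑_) v))))
  substitute-parallel (a ∷ u) (suc i) (suc (suc j)) v w (suc l) (ℕ.s≤s i<j) (ℕ.s≤s j<n) l≡ =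
    cong (a ∷_) (substitute-parallel u i (suc j) v w l i<j j<n (ℕ.suc-injective l≡))
  substitute-parallel (a ∷ u) (suc i) (suc zero) v w l (ℕ.s≤s ()) _ _

  word≡ : ∀ {u v : Word} → proj₁ u ≡ proj₁ v → u ≡ v
  word≡ {u , p} {_ , q} refl = cong (u ,_) (ℕ.≡-irrelevant p q)

  -- The value for i ≥ length u, where the substituted list need not be a word, is arbitrary.
  insert : Word → ℕ → Word → Word
  insert (u , u1) i (v , v1) with i ℕ.<? length u
  ... | yes i<n = substitute u i v , ≡.trans (zeros-substitute u i v v1 i<n) u1
  ... | no  _   = u , u1

  insert-letters : ∀ u i v → i ℕ.< length (proj₁ u) →
                   proj₁ (insert u i v) ≡ substitute (proj₁ u) i (proj₁ v)
  insert-letters (u , _) i v i<n with i ℕ.<? length u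
  ... | yes _   = refl
  ... | no  i≮n = ⊥-elim (i≮n i<n)

  length-insert : ∀ u i v → i ℕ.< length (proj₁ u) →
                  suc (length (proj₁ (insert u i v))) ≡ length (proj₁ u) + length (proj₁ v)
  length-insert u i v i<n =
    ≡.trans (cong (λ w → suc (length w)) (insert-letters u i v i<n))
            (length-substitute (proj₁ u) i (proj₁ v) i<n)

  in-insert : ∀ u i v j → i ℕ.< length (proj₁ u) → j ℕ.< length (proj₁ v) →
              i + j ℕ.< length (proj₁ (insert u i v))
  in-insert u i v j i<n j<m = ℕ.s<s⁻¹ (begin-strict
    suc i + j                             ≤⟨ ℕ.+-monoˡ-≤ j i<n ⟩
    length (proj₁ u) + j                  <⟨ ℕ.+-monoʳ-< (length (proj₁ u)) j<m ⟩
    length (proj₁ u) + length (proj₁ v)   ≡⟨ length-insert u i v i<n ⟨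
    suc (length (proj₁ (insert u i v)))   ∎)
    where open ℕ.≤-Reasoning

  insert-sequential : ∀ u i v j w → i ℕ.< length (proj₁ u) → j ℕ.< length (proj₁ v) →
                      insert (insert u i v) (i + j) w ≡ insert u i (insert v j w)
  insert-sequential u i v j w i<n j<m = word≡ (begin
    proj₁ (insert (insert u i v) (i + j) w)
      ≡⟨ insert-letters (insert u i v) (i + j) w (in-insert u i v j i<n j<m) ⟩
    substitute (proj₁ (insert u i v)) (i + j) (proj₁ w)
      ≡⟨ cong (λ x → substitute x (i + j) (proj₁ w)) (insert-letters u i v i<n) ⟩
    substitute (substitute (proj₁ u) i (proj₁ v)) (i + j) (proj₁ w)
      ≡⟨ substitute-sequential (proj₁ u) i (proj₁ v) j (proj₁ w) i<n j<m ⟩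
    substitute (proj₁ u) i (substitute (proj₁ v) j (proj₁ w))
      ≡⟨ cong (substitute (proj₁ u) i) (insert-letters v j w j<m) ⟨
    substitute (proj₁ u) i (proj₁ (insert v j w))
      ≡⟨ insert-letters u i (insert v j w) i<n ⟨
    proj₁ (insert u i (insert v j w)) ∎)
    where open ≡.≡-Reasoning

  insert-parallel : ∀ u i j v w l → i ℕ.< j → j ℕ.< length (proj₁ u) → suc l ≡ j + length (proj₁ v) →
                    insert (insert u i v) l w ≡ insert (insert u j w) i v
  insert-parallel u i j v w l i<j j<n l≡ = word≡ (begin
    proj₁ (insert (insert u i v) l w)
      ≡⟨ insert-letters (insert u i v) l w l< ⟩
    substitute (proj₁ (insert u i v)) l (proj₁ w)
      ≡⟨ cong (λ x → substitute x l (proj₁ w)) (insert-letters u i v i<n) ⟩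
    substitute (substitute (proj₁ u) i (proj₁ v)) l (proj₁ w)
      ≡⟨ substitute-parallel (proj₁ u) i j (proj₁ v) (proj₁ w) l i<j j<n l≡ ⟩
    substitute (substitute (proj₁ u) j (proj₁ w)) i (proj₁ v)
      ≡⟨ cong (λ x → substitute x i (proj₁ v)) (insert-letters u j w j<n) ⟨
    substitute (proj₁ (insert u j w)) i (proj₁ v)
      ≡⟨ insert-letters (insert u j w) i v i< ⟨
    proj₁ (insert (insert u j w) i v) ∎)
    where
    open ≡.≡-Reasoning
    i<n : i ℕ.< length (proj₁ u)
    i<n = ℕ.<-trans i<j j<n
    l< : l ℕ.< length (proj₁ (insert u i v))
    l< = ℕ.s<s⁻¹ (≡.subst₂ ℕ._<_ (≡.sym l≡) (≡.sym (length-insert u i v i<n))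
           (ℕ.+-monoˡ-< (length (proj₁ v)) j<n))
    i< : i ℕ.< length (proj₁ (insert u j w))
    i< = ℕ.s<s⁻¹ (subst (suc i ℕ.<_) (≡.sym (length-insert u j w j<n))
           (ℕ.≤-<-trans i<j (ℕ.<-≤-trans j<n (ℕ.m≤m+n _ _))))

  setOperad : SetOperad _
  setOperad = record
    { Elem        = Word
    ; arity       = λ u → length (proj₁ u)
    ; unit        = zero ∷ [] , refl
    ; graft       = insert
    ; arity-unit  = refl
    ; arity-graft = λ u i v → length-insert u i v
    ; identityˡ   = λ u → word≡ (≡.trans (++-identityʳ (map (zero ↑_) (proj₁ u))) (map-0↑ (proj₁ u)))
    ; identityʳ   = λ u i i<n → word≡ (≡.trans (insert-letters u i (zero ∷ [] , refl) i<n)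
                                              (substitute-identityʳ (proj₁ u) i))
    ; sequential  = insert-sequential
    ; parallel    = insert-parallel
    }

infix 10 ⊣_ ⊢_
data DiasGenerator (γ : ℕ) : Set where
  ⊣_ ⊢_ : Fin γ → DiasGenerator γ

infix 10 ↼_ ⇀_
data DendrGenerator (γ : ℕ) : Set where
  ↼_ ⇀_ : Fin γ → DendrGenerator γ

module Evaluation (γ : ℕ) where
  open Words γ
  open Trees (DiasGenerator γ)
  open ≡.≡-Reasoning

  T : Set
  T = Tree (DiasGenerator γ)

  letters : T → List Letter
  letters leaf             = zero ∷ []
  letters (node (⊣ a) l r) = letters l ++ map (suc a ↑_) (letters r)
  letters (node (⊢ a) l r) = map (suc a ↑_) (letters l) ++ letters r

  zeros-letters : ∀ t → zeros (letters t) ≡ 1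
  zeros-letters leaf             = refl
  zeros-letters (node (⊣ a) l r) =
    ≡.trans (zeros-++ (letters l) (map (suc a ↑_) (letters r)))
            (cong₂ _+_ (zeros-letters l) (zeros-↑ a (letters r)))
  zeros-letters (node (⊢ a) l r) =
    ≡.trans (zeros-++ (map (suc a ↑_) (letters l)) (letters r))
            (cong₂ _+_ (zeros-↑ a (letters l)) (zeros-letters r))

  length-letters : ∀ t → length (letters t) ≡ leaves t
  length-letters leaf             = refl
  length-letters (node (⊣ a) l r) =
    ≡.trans (length-++ (letters l))
            (cong₂ _+_ (length-letters l) (≡.trans (length-map (suc a ↑_) (letters r)) (length-letters r)))
  length-letters (node (⊢ a) l r) =
    ≡.trans (length-++ (map (suc a ↑_) (letters l)))
            (cong₂ _+_ (≡.trans (length-map (suc a ↑_) (letters l)) (length-letters l)) (length-letters r))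

  evaluate : T → Word
  evaluate t = letters t , zeros-letters t

  substitute-++ʳ′ : ∀ u v i w k → k ≡ length u → substitute (u ++ v) (k + i) w ≡ u ++ substitute v i w
  substitute-++ʳ′ u v i w _ refl = substitute-++ʳ u v i w

  letters-graft : ∀ t i s → i ℕ.< leaves t → letters (graft t i s) ≡ substitute (letters t) i (letters s)
  letters-graft leaf zero s _ = ≡.sym (≡.trans (++-identityʳ (map (zero ↑_) (letters s))) (map-0↑ (letters s)))
  letters-graft leaf (suc i) s (ℕ.s≤s ())
  letters-graft (node (⊣ a) l r) i s i<n with side l r i i<n
  ... | left i<l = begin
    letters (graft (node (⊣ a) l r) i s)
      ≡⟨ cong letters (graft-left (⊣ a) l r i s i<l) ⟩
    letters (graft l i s) ++ map (suc a ↑_) (letters r)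
      ≡⟨ cong (_++ map (suc a ↑_) (letters r)) (letters-graft l i s i<l) ⟩
    substitute (letters l) i (letters s) ++ map (suc a ↑_) (letters r)
      ≡⟨ substitute-++ˡ (letters l) (map (suc a ↑_) (letters r)) i (letters s)
           (subst (i ℕ.<_) (≡.sym (length-letters l)) i<l) ⟨
    substitute (letters l ++ map (suc a ↑_) (letters r)) i (letters s) ∎
  ... | right j j<r = begin
    letters (graft (node (⊣ a) l r) (leaves l + j) s)
      ≡⟨ cong letters (graft-right (⊣ a) l r j s) ⟩
    letters l ++ map (suc a ↑_) (letters (graft r j s))
      ≡⟨ cong (λ w → letters l ++ map (suc a ↑_) w) (letters-graft r j s j<r) ⟩
    letters l ++ map (suc a ↑_) (substitute (letters r) j (letters s))
      ≡⟨ cong (letters l ++_) (substitute-map (suc a) (letters r) j (letters s)) ⟨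
    letters l ++ substitute (map (suc a ↑_) (letters r)) j (letters s)
      ≡⟨ substitute-++ʳ′ (letters l) (map (suc a ↑_) (letters r)) j (letters s) (leaves l) (≡.sym (length-letters l)) ⟨
    substitute (letters l ++ map (suc a ↑_) (letters r)) (leaves l + j) (letters s) ∎
  letters-graft (node (⊢ a) l r) i s i<n with side l r i i<n
  ... | left i<l = begin
    letters (graft (node (⊢ a) l r) i s)
      ≡⟨ cong letters (graft-left (⊢ a) l r i s i<l) ⟩
    map (suc a ↑_) (letters (graft l i s)) ++ letters r
      ≡⟨ cong (λ w → map (suc a ↑_) w ++ letters r) (letters-graft l i s i<l) ⟩
    map (suc a ↑_) (substitute (letters l) i (letters s)) ++ letters r
      ≡⟨ cong (_++ letters r) (substitute-map (suc a) (letters l) i (letters s)) ⟨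
    substitute (map (suc a ↑_) (letters l)) i (letters s) ++ letters r
      ≡⟨ substitute-++ˡ (map (suc a ↑_) (letters l)) (letters r) i (letters s)
           (subst (i ℕ.<_) (≡.sym (≡.trans (length-map (suc a ↑_) (letters l)) (length-letters l))) i<l) ⟨
    substitute (map (suc a ↑_) (letters l) ++ letters r) i (letters s) ∎
  ... | right j j<r = begin
    letters (graft (node (⊢ a) l r) (leaves l + j) s)
      ≡⟨ cong letters (graft-right (⊢ a) l r j s) ⟩
    map (suc a ↑_) (letters l) ++ letters (graft r j s)
      ≡⟨ cong (map (suc a ↑_) (letters l) ++_) (letters-graft r j s j<r) ⟩
    map (suc a ↑_) (letters l) ++ substitute (letters r) j (letters s)
      ≡⟨ substitute-++ʳ′ (map (suc a ↑_) (letters l)) (letters r) j (letters s) (leaves l)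
           (≡.sym (≡.trans (length-map (suc a ↑_) (letters l)) (length-letters l))) ⟨
    substitute (map (suc a ↑_) (letters l) ++ letters r) (leaves l + j) (letters s) ∎

  -- Rule g h g′ h′  stands for the relator  g ∘₁ h − g′ ∘₂ h′.
  data Rule : (g h g′ h′ : DiasGenerator γ) → Set where
    ⊣⊢ : ∀ a a′ → Rule (⊣ a)        (⊢ a′)       (⊢ a′)       (⊣ a)
    ⊣₂ : ∀ a a′ → Rule (⊣ a)        (⊣ (a ↑ a′)) (⊣ a)        (⊢ a′)
    ⊢₂ : ∀ a a′ → Rule (⊢ a)        (⊣ a′)       (⊢ a)        (⊢ (a ↑ a′))
    ⊣⊣ : ∀ a a′ → Rule (⊣ (a ↑ a′)) (⊣ a)        (⊣ a)        (⊣ a′)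
    ⊢⊢ : ∀ a a′ → Rule (⊢ a)        (⊢ a′)       (⊢ (a ↑ a′)) (⊢ a)

  infix 4 _~_
  data _~_ : Rel T Level.zero where
    ~refl  : ∀ {t} → t ~ t
    ~sym   : ∀ {t s} → t ~ s → s ~ t
    ~trans : ∀ {t s u} → t ~ s → s ~ u → t ~ u
    ~node  : ∀ g {l l′ r r′} → l ~ l′ → r ~ r′ → node g l r ~ node g l′ r′
    ~rule  : ∀ {g h g′ h′} → Rule g h g′ h′ → ∀ x y z → node g (node h x y) z ~ node g′ x (node h′ y z)

  prefix : List (Fin γ) → T → T
  prefix []      t = t
  prefix (a ∷ u) t = node (⊢ a) leaf (prefix u t)

  suffix : T → List (Fin γ) → T
  suffix t []      = t
  suffix t (b ∷ v) = suffix (node (⊣ b) t leaf) v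

  prefix-cong : ∀ u {t s} → t ~ s → prefix u t ~ prefix u s
  prefix-cong []      p = p
  prefix-cong (a ∷ u) p = ~node (⊢ a) ~refl (prefix-cong u p)

  suffix-cong : ∀ v {t s} → t ~ s → suffix t v ~ suffix s v
  suffix-cong []      p = p
  suffix-cong (b ∷ v) p = suffix-cong v (~node (⊣ b) p ~refl)

  prefix-++ : ∀ u v t → prefix (u ++ v) t ≡ prefix u (prefix v t)
  prefix-++ []      v t = refl
  prefix-++ (a ∷ u) v t = cong (node (⊢ a) leaf) (prefix-++ u v t)

  suffix-++ : ∀ t u v → suffix t (u ++ v) ≡ suffix (suffix t u) v
  suffix-++ t []      v = refl
  suffix-++ t (b ∷ u) v = suffix-++ (node (⊣ b) t leaf) u v

  ~reflexive : ∀ {t s} → t ≡ s → t ~ s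
  ~reflexive refl = ~refl

  ⊣-prefixˡ : ∀ a u t s → node (⊣ a) (prefix u t) s ~ prefix u (node (⊣ a) t s)
  ⊣-prefixˡ a []      t s = ~refl
  ⊣-prefixˡ a (b ∷ u) t s =
    ~trans (~rule (⊣⊢ a b) leaf (prefix u t) s) (~node (⊢ b) ~refl (⊣-prefixˡ a u t s))

  ⊣-suffixʳ : ∀ a t s v → node (⊣ a) t (suffix s v) ~ suffix (node (⊣ a) t s) (map (a ↑_) v)
  ⊣-suffixʳ a t s []      = ~refl
  ⊣-suffixʳ a t s (b ∷ v) =
    ~trans (⊣-suffixʳ a t (node (⊣ b) s leaf) v)
           (suffix-cong (map (a ↑_) v) (~sym (~rule (⊣⊣ a b) t s leaf)))

  ⊣-prefixʳ : ∀ a t u s → node (⊣ a) t (prefix u s) ~ node (⊣ a) (suffix t (map (a ↑_) u)) s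
  ⊣-prefixʳ a t []      s = ~refl
  ⊣-prefixʳ a t (b ∷ u) s =
    ~trans (~sym (~rule (⊣₂ a b) t leaf (prefix u s))) (⊣-prefixʳ a (node (⊣ (a ↑ b)) t leaf) u s)

  ⊢-prefixˡ : ∀ a u t s → node (⊢ a) (prefix u t) s ~ prefix (map (a ↑_) u) (node (⊢ a) t s)
  ⊢-prefixˡ a []      t s = ~refl
  ⊢-prefixˡ a (b ∷ u) t s =
    ~trans (~rule (⊢⊢ a b) leaf (prefix u t) s) (~node (⊢ (a ↑ b)) ~refl (⊢-prefixˡ a u t s))

  ⊢-suffixˡ : ∀ a t v s → node (⊢ a) (suffix t v) s ~ node (⊢ a) t (prefix (map (a ↑_) v) s)
  ⊢-suffixˡ a t []      s = ~refl
  ⊢-suffixˡ a t (b ∷ v) s =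
    ~trans (⊢-suffixˡ a (node (⊣ b) t leaf) v s) (~rule (⊢₂ a b) t leaf (prefix (map (a ↑_) v) s))

  word : List (Fin γ) → List (Fin γ) → List Letter
  word u v = map suc u ++ zero ∷ map suc v

  ↑-suc : ∀ a (u : List (Fin γ)) → map (suc a ↑_) (map suc u) ≡ map suc (map (a ↑_) u)
  ↑-suc a []      = refl
  ↑-suc a (b ∷ u) = cong (suc (a ↑ b) ∷_) (↑-suc a u)

  ↑-word : ∀ a u v → map (suc a ↑_) (word u v) ≡ map suc (map (a ↑_) u ++ a ∷ map (a ↑_) v)
  ↑-word a u v = begin
    map (suc a ↑_) (word u v)
      ≡⟨ map-++ (suc a ↑_) (map suc u) (zero ∷ map suc v) ⟩
    map (suc a ↑_) (map suc u) ++ suc a ∷ map (suc a ↑_) (map suc v)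
      ≡⟨ cong₂ (λ x y → x ++ suc a ∷ y) (↑-suc a u) (↑-suc a v) ⟩
    map suc (map (a ↑_) u) ++ suc a ∷ map suc (map (a ↑_) v)
      ≡⟨ map-++ suc (map (a ↑_) u) (a ∷ map (a ↑_) v) ⟨
    map suc (map (a ↑_) u ++ a ∷ map (a ↑_) v) ∎

  record Reduced (t : T) : Set where
    constructor reduced
    field
      before after : List (Fin γ)
      letters≡     : letters t ≡ word before after
      reduces      : t ~ prefix before (suffix leaf after)

  reduce : ∀ t → Reduced t
  reduce leaf = reduced [] [] refl ~refl
  reduce (node (⊣ a) l r) with reduce l | reduce r
  ... | reduced u v l≡ l~ | reduced u′ v′ r≡ r~ = reduced u (v ++ w) eq (
    ~trans (~node (⊣ a) l~ r~)
    (~trans (⊣-prefixˡ a u (suffix leaf v) (prefix u′ (suffix leaf v′)))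
    (prefix-cong u
    (~trans (⊣-prefixʳ a (suffix leaf v) u′ (suffix leaf v′))
    (~trans (⊣-suffixʳ a (suffix (suffix leaf v) (map (a ↑_) u′)) leaf v′)
    (~reflexive (≡.sym (≡.trans (suffix-++ leaf v w)
                                (suffix-++ (suffix leaf v) (map (a ↑_) u′) (a ∷ map (a ↑_) v′))))))))))
    where
    w = map (a ↑_) u′ ++ a ∷ map (a ↑_) v′
    eq : letters l ++ map (suc a ↑_) (letters r) ≡ word u (v ++ w)
    eq = begin
      letters l ++ map (suc a ↑_) (letters r)          ≡⟨ cong₂ (λ x y → x ++ map (suc a ↑_) y) l≡ r≡ ⟩
      word u v ++ map (suc a ↑_) (word u′ v′)          ≡⟨ cong (word u v ++_) (↑-word a u′ v′) ⟩
      word u v ++ map suc w                            ≡⟨ ++-assoc (map suc u) (zero ∷ map suc v) (map suc w) ⟩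
      map suc u ++ zero ∷ (map suc v ++ map suc w)     ≡⟨ cong (λ x → map suc u ++ zero ∷ x) (map-++ suc v w) ⟨
      word u (v ++ w)                                  ∎
  reduce (node (⊢ a) l r) with reduce l | reduce r
  ... | reduced u v l≡ l~ | reduced u′ v′ r≡ r~ = reduced (w ++ u′) v′ eq (
    ~trans (~node (⊢ a) l~ r~)
    (~trans (⊢-prefixˡ a u (suffix leaf v) (prefix u′ (suffix leaf v′)))
    (~trans (prefix-cong (map (a ↑_) u) (⊢-suffixˡ a leaf v (prefix u′ (suffix leaf v′))))
    (~reflexive (≡.sym (≡.trans (prefix-++ w u′ (suffix leaf v′))
                                (prefix-++ (map (a ↑_) u) (a ∷ map (a ↑_) v) (prefix u′ (suffix leaf v′)))))))))
    where
    w = map (a ↑_) u ++ a ∷ map (a ↑_) v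
    eq : map (suc a ↑_) (letters l) ++ letters r ≡ word (w ++ u′) v′
    eq = begin
      map (suc a ↑_) (letters l) ++ letters r          ≡⟨ cong₂ (λ x y → map (suc a ↑_) x ++ y) l≡ r≡ ⟩
      map (suc a ↑_) (word u v) ++ word u′ v′          ≡⟨ cong (_++ word u′ v′) (↑-word a u v) ⟩
      map suc w ++ (map suc u′ ++ zero ∷ map suc v′)   ≡⟨ ++-assoc (map suc w) (map suc u′) (zero ∷ map suc v′) ⟨
      (map suc w ++ map suc u′) ++ zero ∷ map suc v′   ≡⟨ cong (_++ zero ∷ map suc v′) (map-++ suc w u′) ⟨
      word (w ++ u′) v′                                ∎

  normalAfter : T → List Letter → T
  normalAfter t []          = t
  normalAfter t (zero  ∷ w) = normalAfter t w
  normalAfter t (suc b ∷ w) = normalAfter (node (⊣ b) t leaf) w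

  normal : List Letter → T
  normal []          = leaf
  normal (zero  ∷ w) = normalAfter leaf w
  normal (suc a ∷ w) = node (⊢ a) leaf (normal w)

  normalAfter-suc : ∀ t v → normalAfter t (map suc v) ≡ suffix t v
  normalAfter-suc t []      = refl
  normalAfter-suc t (b ∷ v) = normalAfter-suc (node (⊣ b) t leaf) v

  normal-word : ∀ u v → normal (word u v) ≡ prefix u (suffix leaf v)
  normal-word []      v = normalAfter-suc leaf v
  normal-word (a ∷ u) v = cong (node (⊢ a) leaf) (normal-word u v)

  ~normal : ∀ t → t ~ normal (letters t)
  ~normal t = ~trans reduces (~reflexive (≡.trans (≡.sym (normal-word before after)) (cong normal (≡.sym letters≡))))
    where open Reduced (reduce t)

  letters-normalAfter : ∀ t w → zeros w ≡ 0 → letters (normalAfter t w) ≡ letters t ++ w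
  letters-normalAfter t []          _ = ≡.sym (++-identityʳ (letters t))
  letters-normalAfter t (suc b ∷ w) p =
    ≡.trans (letters-normalAfter (node (⊣ b) t leaf) w p) (++-assoc (letters t) (suc b ∷ []) w)

  letters-normal : ∀ w → zeros w ≡ 1 → letters (normal w) ≡ w
  letters-normal (zero  ∷ w) p = letters-normalAfter leaf w (ℕ.suc-injective p)
  letters-normal (suc a ∷ w) p = cong (suc a ∷_) (letters-normal w p)

  evaluate-normal : ∀ (w : Word) → evaluate (normal (proj₁ w)) ≡ w
  evaluate-normal (w , p) = word≡ (letters-normal w p)

  leaves-normal : ∀ (w : Word) → leaves (normal (proj₁ w)) ≡ length (proj₁ w)
  leaves-normal (w , p) = ≡.trans (≡.sym (length-letters (normal w))) (cong length (letters-normal w p))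

  ~leaves : ∀ {t s} → t ~ s → leaves t ≡ leaves s
  ~leaves ~refl            = refl
  ~leaves (~sym p)         = ≡.sym (~leaves p)
  ~leaves (~trans p q)     = ≡.trans (~leaves p) (~leaves q)
  ~leaves (~node g p q)    = cong₂ _+_ (~leaves p) (~leaves q)
  ~leaves (~rule _ x y z)  = ℕ.+-assoc (leaves x) (leaves y) (leaves z)

  ~letters : ∀ {g h g′ h′} → Rule g h g′ h′ →
             letters (node g (node h leaf leaf) leaf) ≡ letters (node g′ leaf (node h′ leaf leaf))
  ~letters (⊣⊢ a b) = refl
  ~letters (⊣₂ a b) = refl
  ~letters (⊢₂ a b) = refl
  ~letters (⊣⊣ a b) = refl
  ~letters (⊢⊢ a b) = refl

module Over {c ℓ₁ ℓ₂ : Level} (K : HeytingField c ℓ₁ ℓ₂) where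

  private
    commutativeRing : CommutativeRing c ℓ₁
    commutativeRing = HeytingCommutativeRing.commutativeRing (HeytingField.heytingCommutativeRing K)
    module K = CommutativeRing commutativeRing

  open K using () renaming (Carrier to 𝕂; ring to 𝕂-ring)

  Space : (m ℓm : Level) → Set (c ⊔ ℓ₁ ⊔ lsuc (m ⊔ ℓm))
  Space = LeftModule 𝕂-ring

  ∣_∣ : ∀ {m ℓm} → Space m ℓm → Set m
  ∣ V ∣ = LeftModule.Carrierᴹ V

  scalars : Space c ℓ₁
  scalars = TensorUnit.leftModule {R = 𝕂-ring}

  module SpaceLemmas {m ℓm : Level} (V : Space m ℓm) where
    open LeftModule V public
    open AbelianGroupProperties +ᴹ-abelianGroup public
      using (⁻¹-∙-comm; inverseʳ-unique; inverseˡ-unique; x∙y⁻¹≈ε⇒x≈y; x≈y⇒x∙y⁻¹≈ε; ⁻¹-involutive; ε⁻¹≈ε)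
    open SetoidReasoning ≈ᴹ-setoid public

    infixl 6 _-ᴹ_
    _-ᴹ_ : ∣ V ∣ → ∣ V ∣ → ∣ V ∣
    x -ᴹ y = x +ᴹ -ᴹ y

    interchange : ∀ x y z w → (x +ᴹ y) +ᴹ (z +ᴹ w) ≈ᴹ (x +ᴹ z) +ᴹ (y +ᴹ w)
    interchange x y z w = begin
      (x +ᴹ y) +ᴹ (z +ᴹ w) ≈⟨ +ᴹ-assoc x y _ ⟩
      x +ᴹ (y +ᴹ (z +ᴹ w)) ≈⟨ +ᴹ-congˡ (≈ᴹ-sym (+ᴹ-assoc y z w)) ⟩
      x +ᴹ ((y +ᴹ z) +ᴹ w) ≈⟨ +ᴹ-congˡ (+ᴹ-congʳ (+ᴹ-comm y z)) ⟩
      x +ᴹ ((z +ᴹ y) +ᴹ w) ≈⟨ +ᴹ-congˡ (+ᴹ-assoc z y w) ⟩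
      x +ᴹ (z +ᴹ (y +ᴹ w)) ≈⟨ +ᴹ-assoc x z _ ⟨
      (x +ᴹ z) +ᴹ (y +ᴹ w) ∎

    neg≈-1* : ∀ x → -ᴹ x ≈ᴹ (K.- K.1#) *ₗ x
    neg≈-1* x = ≈ᴹ-sym (inverseʳ-unique x _ (begin
      x +ᴹ (K.- K.1#) *ₗ x            ≈⟨ +ᴹ-congʳ (*ₗ-identityˡ x) ⟨
      K.1# *ₗ x +ᴹ (K.- K.1#) *ₗ x    ≈⟨ *ₗ-distribʳ x K.1# (K.- K.1#) ⟨
      (K.1# K.+ K.- K.1#) *ₗ x        ≈⟨ *ₗ-congʳ (K.-‿inverseʳ K.1#) ⟩
      K.0# *ₗ x                       ≈⟨ *ₗ-zeroˡ x ⟩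
      0ᴹ                              ∎))

    *ₗ-neg : ∀ k x → k *ₗ (-ᴹ x) ≈ᴹ -ᴹ (k *ₗ x)
    *ₗ-neg k x = inverseʳ-unique _ _ (begin
      k *ₗ x +ᴹ k *ₗ (-ᴹ x) ≈⟨ *ₗ-distribˡ k x (-ᴹ x) ⟨
      k *ₗ (x +ᴹ -ᴹ x)      ≈⟨ *ₗ-congˡ (-ᴹ‿inverseʳ x) ⟩
      k *ₗ 0ᴹ               ≈⟨ *ₗ-zeroʳ k ⟩
      0ᴹ                    ∎)

    *ₗ-comm : ∀ k l x → k *ₗ (l *ₗ x) ≈ᴹ l *ₗ (k *ₗ x)
    *ₗ-comm k l x = begin
      k *ₗ (l *ₗ x)   ≈⟨ *ₗ-assoc k l x ⟨
      (k K.* l) *ₗ x  ≈⟨ *ₗ-congʳ (K.*-comm k l) ⟩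
      (l K.* k) *ₗ x  ≈⟨ *ₗ-assoc l k x ⟩
      l *ₗ (k *ₗ x)   ∎

    -‿telescope : ∀ x y z → (x -ᴹ y) +ᴹ (y -ᴹ z) ≈ᴹ x -ᴹ z
    -‿telescope x y z = begin
      (x -ᴹ y) +ᴹ (y -ᴹ z)        ≈⟨ +ᴹ-assoc x _ _ ⟩
      x +ᴹ (-ᴹ y +ᴹ (y -ᴹ z))     ≈⟨ +ᴹ-congˡ (≈ᴹ-sym (+ᴹ-assoc _ y _)) ⟩
      x +ᴹ ((-ᴹ y +ᴹ y) +ᴹ -ᴹ z)  ≈⟨ +ᴹ-congˡ (+ᴹ-congʳ (-ᴹ‿inverseˡ y)) ⟩
      x +ᴹ (0ᴹ +ᴹ -ᴹ z)           ≈⟨ +ᴹ-congˡ (+ᴹ-identityˡ _) ⟩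
      x -ᴹ z                      ∎

    -‿flip : ∀ x y → -ᴹ (x -ᴹ y) ≈ᴹ y -ᴹ x
    -‿flip x y = begin
      -ᴹ (x -ᴹ y)      ≈⟨ ⁻¹-∙-comm x (-ᴹ y) ⟨
      -ᴹ x +ᴹ -ᴹ -ᴹ y  ≈⟨ +ᴹ-comm _ _ ⟩
      -ᴹ -ᴹ y +ᴹ -ᴹ x  ≈⟨ +ᴹ-congʳ (⁻¹-involutive y) ⟩
      y -ᴹ x           ∎

    -‿+ : ∀ x x′ y y′ → (x +ᴹ y) -ᴹ (x′ +ᴹ y′) ≈ᴹ (x -ᴹ x′) +ᴹ (y -ᴹ y′)
    -‿+ x x′ y y′ = ≈ᴹ-trans (+ᴹ-congˡ (≈ᴹ-sym (⁻¹-∙-comm x′ y′))) (interchange x y (-ᴹ x′) (-ᴹ y′))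

  -- The space with basis B: formal linear combinations, modulo the axioms of a 𝕂-module.
  infixl 6 _⊕_
  infixr 7 _⊙_
  infixr 8 ⊖_
  data Combination {b : Level} (B : Set b) : Set (c ⊔ b) where
    ⟨_⟩ : B → Combination B
    𝟎   : Combination B
    _⊕_ : Combination B → Combination B → Combination B
    ⊖_  : Combination B → Combination B
    _⊙_ : 𝕂 → Combination B → Combination B

  infix 4 _≋_
  data _≋_ {b : Level} {B : Set b} : Rel (Combination B) (c ⊔ ℓ₁ ⊔ b) where
    ≋-refl       : ∀ {x} → x ≋ x
    ≋-sym        : ∀ {x y} → x ≋ y → y ≋ x
    ≋-trans      : ∀ {x y z} → x ≋ y → y ≋ z → x ≋ z
    ⊕-cong       : ∀ {x x′ y y′} → x ≋ x′ → y ≋ y′ → x ⊕ y ≋ x′ ⊕ y′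
    ⊖-cong       : ∀ {x x′} → x ≋ x′ → ⊖ x ≋ ⊖ x′
    ⊙-cong       : ∀ {k k′ x x′} → k K.≈ k′ → x ≋ x′ → k ⊙ x ≋ k′ ⊙ x′
    ⊕-assoc      : ∀ x y z → (x ⊕ y) ⊕ z ≋ x ⊕ (y ⊕ z)
    ⊕-comm       : ∀ x y → x ⊕ y ≋ y ⊕ x
    ⊕-identityˡ  : ∀ x → 𝟎 ⊕ x ≋ x
    ⊖-inverseˡ   : ∀ x → ⊖ x ⊕ x ≋ 𝟎
    ⊙-zeroˡ      : ∀ x → K.0# ⊙ x ≋ 𝟎
    ⊙-zeroʳ      : ∀ k → k ⊙ 𝟎 ≋ 𝟎
    ⊙-identityˡ  : ∀ x → K.1# ⊙ x ≋ x
    ⊙-assoc      : ∀ k l x → (k K.* l) ⊙ x ≋ k ⊙ (l ⊙ x)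
    ⊙-distribˡ   : ∀ k x y → k ⊙ (x ⊕ y) ≋ k ⊙ x ⊕ k ⊙ y
    ⊙-distribʳ   : ∀ x k l → (k K.+ l) ⊙ x ≋ k ⊙ x ⊕ l ⊙ x

  freeSpace : ∀ {b} → Set b → Space (c ⊔ b) (c ⊔ ℓ₁ ⊔ b)
  freeSpace B = record
    { Carrierᴹ = Combination B
    ; _≈ᴹ_ = _≋_
    ; _+ᴹ_ = _⊕_
    ; _*ₗ_ = _⊙_
    ; 0ᴹ = 𝟎
    ; -ᴹ_ = ⊖_
    ; isLeftModule = record
      { isLeftSemimodule = record
        { +ᴹ-isCommutativeMonoid = record
          { isMonoid = record
            { isSemigroup = record
              { isMagma = record
                { isEquivalence = record { refl = ≋-refl ; sym = ≋-sym ; trans = ≋-trans }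
                ; ∙-cong = ⊕-cong
                }
              ; assoc = ⊕-assoc
              }
            ; identity = ⊕-identityˡ , λ x → ≋-trans (⊕-comm x 𝟎) (⊕-identityˡ x)
            }
          ; comm = ⊕-comm
          }
        ; isPreleftSemimodule = record
          { *ₗ-cong = ⊙-cong
          ; *ₗ-zeroˡ = ⊙-zeroˡ
          ; *ₗ-distribʳ = ⊙-distribʳ
          ; *ₗ-identityˡ = ⊙-identityˡ
          ; *ₗ-assoc = ⊙-assoc
          ; *ₗ-zeroʳ = ⊙-zeroʳ
          ; *ₗ-distribˡ = ⊙-distribˡ
          }
        }
      ; -ᴹ‿cong = ⊖-cong
      ; -ᴹ‿inverse = ⊖-inverseˡ , λ x → ≋-trans (⊕-comm x (⊖ x)) (⊖-inverseˡ x)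
      }
    }

  module Extension {m ℓm : Level} (V : Space m ℓm) where
    open SpaceLemmas V

    extend : ∀ {b} {B : Set b} → (B → ∣ V ∣) → Combination B → ∣ V ∣
    extend f ⟨ b ⟩   = f b
    extend f 𝟎       = 0ᴹ
    extend f (x ⊕ y) = extend f x +ᴹ extend f y
    extend f (⊖ x)   = -ᴹ extend f x
    extend f (k ⊙ x) = k *ₗ extend f x

    extend-cong : ∀ {b} {B : Set b} (f : B → ∣ V ∣) {x y} → x ≋ y → extend f x ≈ᴹ extend f y
    extend-cong f ≋-refl               = ≈ᴹ-refl
    extend-cong f (≋-sym p)            = ≈ᴹ-sym (extend-cong f p)
    extend-cong f (≋-trans p q)        = ≈ᴹ-trans (extend-cong f p) (extend-cong f q)
    extend-cong f (⊕-cong p q)         = +ᴹ-cong (extend-cong f p) (extend-cong f q)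
    extend-cong f (⊖-cong p)           = -ᴹ‿cong (extend-cong f p)
    extend-cong f (⊙-cong k p)         = *ₗ-cong k (extend-cong f p)
    extend-cong f (⊕-assoc x y z)      = +ᴹ-assoc _ _ _
    extend-cong f (⊕-comm x y)         = +ᴹ-comm _ _
    extend-cong f (⊕-identityˡ x)      = +ᴹ-identityˡ _
    extend-cong f (⊖-inverseˡ x)       = -ᴹ‿inverseˡ _
    extend-cong f (⊙-zeroˡ x)          = *ₗ-zeroˡ _
    extend-cong f (⊙-zeroʳ k)          = *ₗ-zeroʳ k
    extend-cong f (⊙-identityˡ x)      = *ₗ-identityˡ _
    extend-cong f (⊙-assoc k l x)      = *ₗ-assoc k l _
    extend-cong f (⊙-distribˡ k x y)   = *ₗ-distribˡ k _ _
    extend-cong f (⊙-distribʳ x k l)   = *ₗ-distribʳ _ k l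

    extend-ext : ∀ {b} {B : Set b} {f g : B → ∣ V ∣} → (∀ b → f b ≈ᴹ g b) →
                 ∀ x → extend f x ≈ᴹ extend g x
    extend-ext f≈g ⟨ b ⟩   = f≈g b
    extend-ext f≈g 𝟎       = ≈ᴹ-refl
    extend-ext f≈g (x ⊕ y) = +ᴹ-cong (extend-ext f≈g x) (extend-ext f≈g y)
    extend-ext f≈g (⊖ x)   = -ᴹ‿cong (extend-ext f≈g x)
    extend-ext f≈g (k ⊙ x) = *ₗ-congˡ (extend-ext f≈g x)

    extend-𝟎 : ∀ {b} {B : Set b} (x : Combination B) → extend (λ _ → 0ᴹ) x ≈ᴹ 0ᴹ
    extend-𝟎 ⟨ b ⟩   = ≈ᴹ-refl
    extend-𝟎 𝟎       = ≈ᴹ-refl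
    extend-𝟎 (x ⊕ y) = ≈ᴹ-trans (+ᴹ-cong (extend-𝟎 x) (extend-𝟎 y)) (+ᴹ-identityˡ 0ᴹ)
    extend-𝟎 (⊖ x)   = ≈ᴹ-trans (-ᴹ‿cong (extend-𝟎 x)) ε⁻¹≈ε
    extend-𝟎 (k ⊙ x) = ≈ᴹ-trans (*ₗ-congˡ (extend-𝟎 x)) (*ₗ-zeroʳ k)

    extend-⊕ : ∀ {b} {B : Set b} (f g : B → ∣ V ∣) x →
               extend (λ b → f b +ᴹ g b) x ≈ᴹ extend f x +ᴹ extend g x
    extend-⊕ f g ⟨ b ⟩   = ≈ᴹ-refl
    extend-⊕ f g 𝟎       = ≈ᴹ-sym (+ᴹ-identityˡ 0ᴹ)
    extend-⊕ f g (x ⊕ y) = ≈ᴹ-trans (+ᴹ-cong (extend-⊕ f g x) (extend-⊕ f g y)) (interchange _ _ _ _)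
    extend-⊕ f g (⊖ x)   = ≈ᴹ-trans (-ᴹ‿cong (extend-⊕ f g x)) (≈ᴹ-sym (⁻¹-∙-comm _ _))
    extend-⊕ f g (k ⊙ x) = ≈ᴹ-trans (*ₗ-congˡ (extend-⊕ f g x)) (*ₗ-distribˡ k _ _)

    extend-⊙ : ∀ {b} {B : Set b} k (f : B → ∣ V ∣) x →
               extend (λ b → k *ₗ f b) x ≈ᴹ k *ₗ extend f x
    extend-⊙ k f ⟨ b ⟩   = ≈ᴹ-refl
    extend-⊙ k f 𝟎       = ≈ᴹ-sym (*ₗ-zeroʳ k)
    extend-⊙ k f (x ⊕ y) = ≈ᴹ-trans (+ᴹ-cong (extend-⊙ k f x) (extend-⊙ k f y)) (≈ᴹ-sym (*ₗ-distribˡ k _ _))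
    extend-⊙ k f (⊖ x)   = ≈ᴹ-trans (-ᴹ‿cong (extend-⊙ k f x)) (≈ᴹ-sym (*ₗ-neg k _))
    extend-⊙ k f (l ⊙ x) = ≈ᴹ-trans (*ₗ-congˡ (extend-⊙ k f x)) (*ₗ-comm l k _)

    extend-⊖ : ∀ {b} {B : Set b} (f : B → ∣ V ∣) x →
               extend (λ b → -ᴹ f b) x ≈ᴹ -ᴹ extend f x
    extend-⊖ f x = begin
      extend (λ b → -ᴹ f b) x              ≈⟨ extend-ext (λ b → neg≈-1* (f b)) x ⟩
      extend (λ b → (K.- K.1#) *ₗ f b) x   ≈⟨ extend-⊙ (K.- K.1#) f x ⟩
      (K.- K.1#) *ₗ extend f x             ≈⟨ neg≈-1* _ ⟨
      -ᴹ extend f x                        ∎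

    extend₂ : ∀ {b b′} {B : Set b} {B′ : Set b′} → (B → B′ → ∣ V ∣) → Combination B → Combination B′ → ∣ V ∣
    extend₂ f x y = extend (λ b → extend (f b) y) x

    extend₂-cong : ∀ {b b′} {B : Set b} {B′ : Set b′} (f : B → B′ → ∣ V ∣) {x x′ y y′} →
                   x ≋ x′ → y ≋ y′ → extend₂ f x y ≈ᴹ extend₂ f x′ y′
    extend₂-cong f {x} {x′} {y} {y′} p q =
      ≈ᴹ-trans (extend-cong (λ b → extend (f b) y) p) (extend-ext (λ b → extend-cong (f b) q) x′)

  open Extension using (extend; extend₂)

  record Subspace {m ℓm : Level} (V : Space m ℓm) (ℓ : Level) : Set (c ⊔ m ⊔ ℓm ⊔ lsuc ℓ) where
    open LeftModule V
    field
      Member   : Pred ∣ V ∣ ℓ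
      resp     : ∀ {x y} → x ≈ᴹ y → Member x → Member y
      0-closed : Member 0ᴹ
      +-closed : ∀ {x y} → Member x → Member y → Member (x +ᴹ y)
      *-closed : ∀ k {x} → Member x → Member (k *ₗ x)

    -‿closed : ∀ {x} → Member x → Member (-ᴹ x)
    -‿closed {x} p = resp (≈ᴹ-sym (SpaceLemmas.neg≈-1* V x)) (*-closed (K.- K.1#) p)

  infix 4 _∈_
  _∈_ : ∀ {m ℓm ℓ} {V : Space m ℓm} → ∣ V ∣ → Subspace V ℓ → Set ℓ
  x ∈ S = Subspace.Member S x

  module _ {m ℓm s : Level} {V : Space m ℓm} (S : Pred ∣ V ∣ s) where
    open LeftModule V

    data Spanned : Pred ∣ V ∣ (c ⊔ m ⊔ ℓm ⊔ s) where
      member : ∀ {x} → S x → Spanned x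
      ≈-in   : ∀ {x y} → x ≈ᴹ y → Spanned x → Spanned y
      0-in   : Spanned 0ᴹ
      +-in   : ∀ {x y} → Spanned x → Spanned y → Spanned (x +ᴹ y)
      *-in   : ∀ k {x} → Spanned x → Spanned (k *ₗ x)

    span : Subspace V (c ⊔ m ⊔ ℓm ⊔ s)
    span = record
      { Member = Spanned ; resp = ≈-in ; 0-closed = 0-in ; +-closed = +-in ; *-closed = *-in }

  quotientSpace : ∀ {m ℓm ℓ} (V : Space m ℓm) → Subspace V ℓ → Space m ℓ
  quotientSpace V S = record
    { Carrierᴹ = ∣ V ∣
    ; _≈ᴹ_ = λ x y → x -ᴹ y ∈ S
    ; _+ᴹ_ = _+ᴹ_
    ; _*ₗ_ = _*ₗ_
    ; 0ᴹ = 0ᴹ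
    ; -ᴹ_ = -ᴹ_
    ; isLeftModule = record
      { isLeftSemimodule = record
        { +ᴹ-isCommutativeMonoid = record
          { isMonoid = record
            { isSemigroup = record
              { isMagma = record
                { isEquivalence = record { refl = from ≈ᴹ-refl ; sym = sym ; trans = trans }
                ; ∙-cong = λ {x} {x′} {y} {y′} p q → resp (≈ᴹ-sym (-‿+ x x′ y y′)) (+-closed p q)
                }
              ; assoc = λ x y z → from (+ᴹ-assoc x y z)
              }
            ; identity = (λ x → from (+ᴹ-identityˡ x)) , (λ x → from (+ᴹ-identityʳ x))
            }
          ; comm = λ x y → from (+ᴹ-comm x y)
          }
        ; isPreleftSemimodule = record
          { *ₗ-cong = λ {k} {k′} {x} {x′} k≈k′ p →
              trans (from (*ₗ-congʳ k≈k′))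
                (resp (≈ᴹ-trans (*ₗ-distribˡ k′ x (-ᴹ x′)) (+ᴹ-congˡ (*ₗ-neg k′ x′))) (*-closed k′ p))
          ; *ₗ-zeroˡ = λ x → from (*ₗ-zeroˡ x)
          ; *ₗ-distribʳ = λ x k l → from (*ₗ-distribʳ x k l)
          ; *ₗ-identityˡ = λ x → from (*ₗ-identityˡ x)
          ; *ₗ-assoc = λ k l x → from (*ₗ-assoc k l x)
          ; *ₗ-zeroʳ = λ k → from (*ₗ-zeroʳ k)
          ; *ₗ-distribˡ = λ k x y → from (*ₗ-distribˡ k x y)
          }
        }
      ; -ᴹ‿cong = λ {x} {y} p → resp (≈ᴹ-sym (⁻¹-∙-comm x (-ᴹ y))) (-‿closed p)
      ; -ᴹ‿inverse = (λ x → from (-ᴹ‿inverseˡ x)) , (λ x → from (-ᴹ‿inverseʳ x))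
      }
    }
    where
    open SpaceLemmas V
    open Subspace S
    from : ∀ {x y} → x ≈ᴹ y → x -ᴹ y ∈ S
    from p = resp (≈ᴹ-sym (x≈y⇒x∙y⁻¹≈ε p)) 0-closed
    sym : ∀ {x y} → x -ᴹ y ∈ S → y -ᴹ x ∈ S
    sym {x} {y} p = resp (-‿flip x y) (-‿closed p)
    trans : ∀ {x y z} → x -ᴹ y ∈ S → y -ᴹ z ∈ S → x -ᴹ z ∈ S
    trans {x} {y} {z} p q = resp (-‿telescope x y z) (+-closed p q)

  module Graded {m ℓm : Level} (V : ℕ → Space m ℓm) where
    module _ {n : ℕ} where
      open LeftModule (V n) public using (_≈ᴹ_; _+ᴹ_; _*ₗ_)

  -- Nonsymmetric operads.  The index r of  comp  is n + m − 1; keeping it as a separate index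
  -- with the equation  suc r ≡ n + m  lets the axioms be stated without transports.
  -- Inputs are numbered from 0.
  record Operad (m ℓm : Level) : Set (c ⊔ ℓ₁ ⊔ lsuc (m ⊔ ℓm)) where
    field
      component : ℕ → Space m ℓm

    open Graded component public

    field
      one  : ∣ component 1 ∣
      comp : ∀ {n m r} → suc r ≡ n + m → Fin n → ∣ component n ∣ → ∣ component m ∣ → ∣ component r ∣

      comp-cong : ∀ {n m r} (e : suc r ≡ n + m) (i : Fin n) {x x′ y y′} →
                  x ≈ᴹ x′ → y ≈ᴹ y′ → comp e i x y ≈ᴹ comp e i x′ y′
      comp-+ˡ   : ∀ {n m r} (e : suc r ≡ n + m) (i : Fin n) x x′ y →
                  comp e i (x +ᴹ x′) y ≈ᴹ comp e i x y +ᴹ comp e i x′ y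
      comp-*ˡ   : ∀ {n m r} (e : suc r ≡ n + m) (i : Fin n) k x y →
                  comp e i (k *ₗ x) y ≈ᴹ k *ₗ comp e i x y
      comp-+ʳ   : ∀ {n m r} (e : suc r ≡ n + m) (i : Fin n) x y y′ →
                  comp e i x (y +ᴹ y′) ≈ᴹ comp e i x y +ᴹ comp e i x y′
      comp-*ʳ   : ∀ {n m r} (e : suc r ≡ n + m) (i : Fin n) k x y →
                  comp e i x (k *ₗ y) ≈ᴹ k *ₗ comp e i x y

      identityˡ  : ∀ {n} (e : suc n ≡ 1 + n) (x : ∣ component n ∣) → comp e zero one x ≈ᴹ x
      identityʳ  : ∀ {n} (e : suc n ≡ n + 1) (i : Fin n) (x : ∣ component n ∣) → comp e i x one ≈ᴹ x
      sequential : ∀ {n m p a b r} (e : suc a ≡ n + m) (f : suc r ≡ a + p)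
                   (e′ : suc b ≡ m + p) (f′ : suc r ≡ n + b) (i : Fin n) (j : Fin m) (k : Fin a) x y z →
                   toℕ k ≡ toℕ i + toℕ j →
                   comp f k (comp e i x y) z ≈ᴹ comp f′ i x (comp e′ j y z)
      parallel   : ∀ {n m p a b r} (e : suc a ≡ n + m) (f : suc r ≡ a + p)
                   (e′ : suc b ≡ n + p) (f′ : suc r ≡ b + m) (i j : Fin n) (k : Fin a) (i′ : Fin b) x y z →
                   i < j → suc (toℕ k) ≡ toℕ j + m → toℕ i′ ≡ toℕ i →
                   comp f k (comp e i x y) z ≈ᴹ comp f′ i′ (comp e′ j x z) y

    comp-neg : ∀ {n m r} (e : suc r ≡ n + m) (i : Fin n) x y →
               comp e i (LeftModule.-ᴹ_ (component n) x) y ≈ᴹ LeftModule.-ᴹ_ (component r) (comp e i x y)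
    comp-neg {n} {m} {r} e i x y = begin
      comp e i (N.-ᴹ x) y             ≈⟨ comp-cong e i (N.neg≈-1* x) (LeftModule.≈ᴹ-refl (component m)) ⟩
      comp e i ((K.- K.1#) *ₗ x) y    ≈⟨ comp-*ˡ e i (K.- K.1#) x y ⟩
      (K.- K.1#) *ₗ comp e i x y      ≈⟨ R.neg≈-1* _ ⟨
      R.-ᴹ comp e i x y               ∎
      where
      module N = SpaceLemmas (component n)
      module R = SpaceLemmas (component r)
      open R using (begin_; step-≈-⟩; step-≈-⟨; _∎)

    comp-negʳ : ∀ {n m r} (e : suc r ≡ n + m) (i : Fin n) x y →
                comp e i x (LeftModule.-ᴹ_ (component m) y) ≈ᴹ LeftModule.-ᴹ_ (component r) (comp e i x y)
    comp-negʳ {n} {m} {r} e i x y = begin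
      comp e i x (M.-ᴹ y)             ≈⟨ comp-cong e i (LeftModule.≈ᴹ-refl (component n)) (M.neg≈-1* y) ⟩
      comp e i x ((K.- K.1#) *ₗ y)    ≈⟨ comp-*ʳ e i (K.- K.1#) x y ⟩
      (K.- K.1#) *ₗ comp e i x y      ≈⟨ R.neg≈-1* _ ⟨
      R.-ᴹ comp e i x y               ∎
      where
      module M = SpaceLemmas (component m)
      module R = SpaceLemmas (component r)
      open R using (begin_; step-≈-⟩; step-≈-⟨; _∎)

  _⦅_⦆ : ∀ {m ℓm} → Operad m ℓm → ℕ → Space m ℓm
  _⦅_⦆ = Operad.component

  module Linearisation {b : Level} (P : SetOperad b) where
    open SetOperad P

    Basis : ℕ → Set b
    Basis n = Σ Elem λ x → arity x ≡ n

    basis≡ : ∀ {n} {s t : Basis n} → proj₁ s ≡ proj₁ t → s ≡ t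
    basis≡ {s = x , p} {_ , q} refl = cong (x ,_) (ℕ.≡-irrelevant p q)

    input : ∀ {n} (s : Basis n) (i : Fin n) → toℕ i ℕ.< arity (proj₁ s)
    input (_ , p) i = subst (toℕ i ℕ.<_) (≡.sym p) (Fin.toℕ<n i)

    compose : ∀ {n m r} → suc r ≡ n + m → Fin n → Basis n → Basis m → Basis r
    compose e i s@(x , p) (y , q) =
      graft x (toℕ i) y ,
      ℕ.suc-injective (≡.trans (arity-graft x (toℕ i) y (input s i))
                               (≡.trans (cong₂ _+_ p q) (≡.sym e)))

    private
      module V n = SpaceLemmas (freeSpace (Basis n))
      module E n = Extension (freeSpace (Basis n))

    lift : ∀ {n} {s t : Basis n} → proj₁ s ≡ proj₁ t → ⟨ s ⟩ ≋ ⟨ t ⟩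
    lift p = V.≈ᴹ-reflexive _ (cong ⟨_⟩ (basis≡ p))

    composeᴸ : ∀ {n m r} → suc r ≡ n + m → Fin n →
               Combination (Basis n) → Combination (Basis m) → Combination (Basis r)
    composeᴸ {r = r} e i = extend₂ (freeSpace (Basis r)) λ s t → ⟨ compose e i s t ⟩

    one : Combination (Basis 1)
    one = ⟨ unit , arity-unit ⟩

    private
      idˡ : ∀ {n} (e : suc n ≡ 1 + n) x → composeᴸ e zero one x ≋ x
      idˡ e ⟨ s ⟩   = lift (identityˡ (proj₁ s))
      idˡ e 𝟎       = ≋-refl
      idˡ e (x ⊕ y) = ⊕-cong (idˡ e x) (idˡ e y)
      idˡ e (⊖ x)   = ⊖-cong (idˡ e x)
      idˡ e (k ⊙ x) = ⊙-cong K.refl (idˡ e x)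

      idʳ : ∀ {n} (e : suc n ≡ n + 1) i x → composeᴸ e i x one ≋ x
      idʳ e i ⟨ s ⟩   = lift (identityʳ (proj₁ s) (toℕ i) (input s i))
      idʳ e i 𝟎       = ≋-refl
      idʳ e i (x ⊕ y) = ⊕-cong (idʳ e i x) (idʳ e i y)
      idʳ e i (⊖ x)   = ⊖-cong (idʳ e i x)
      idʳ e i (k ⊙ x) = ⊙-cong K.refl (idʳ e i x)

      module _ {n m p a b r : ℕ} (e : suc a ≡ n + m) (f : suc r ≡ a + p)
               (e′ : suc b ≡ m + p) (f′ : suc r ≡ n + b)
               (i : Fin n) (j : Fin m) (k : Fin a) (k≡ : toℕ k ≡ toℕ i + toℕ j) where

        seq₃ : ∀ s t z → composeᴸ f k ⟨ compose e i s t ⟩ z ≋ composeᴸ f′ i ⟨ s ⟩ (composeᴸ e′ j ⟨ t ⟩ z)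
        seq₃ s t ⟨ u ⟩   = lift (≡.trans (cong (λ l → graft (graft (proj₁ s) (toℕ i) (proj₁ t)) l (proj₁ u)) k≡)
                             (SetOperad.sequential P (proj₁ s) (toℕ i) (proj₁ t) (toℕ j) (proj₁ u) (input s i) (input t j)))
        seq₃ s t 𝟎       = ≋-refl
        seq₃ s t (x ⊕ y) = ⊕-cong (seq₃ s t x) (seq₃ s t y)
        seq₃ s t (⊖ x)   = ⊖-cong (seq₃ s t x)
        seq₃ s t (l ⊙ x) = ⊙-cong K.refl (seq₃ s t x)

        seq₂ : ∀ s y z → composeᴸ f k (composeᴸ e i ⟨ s ⟩ y) z ≋ composeᴸ f′ i ⟨ s ⟩ (composeᴸ e′ j y z)
        seq₂ s ⟨ t ⟩   z = seq₃ s t z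
        seq₂ s 𝟎       z = ≋-refl
        seq₂ s (x ⊕ y) z = ⊕-cong (seq₂ s x z) (seq₂ s y z)
        seq₂ s (⊖ x)   z = ⊖-cong (seq₂ s x z)
        seq₂ s (l ⊙ x) z = ⊙-cong K.refl (seq₂ s x z)

        seq : ∀ x y z → composeᴸ f k (composeᴸ e i x y) z ≋ composeᴸ f′ i x (composeᴸ e′ j y z)
        seq ⟨ s ⟩    y z = seq₂ s y z
        seq 𝟎        y z = ≋-refl
        seq (x ⊕ x′) y z = ⊕-cong (seq x y z) (seq x′ y z)
        seq (⊖ x)    y z = ⊖-cong (seq x y z)
        seq (l ⊙ x)  y z = ⊙-cong K.refl (seq x y z)

      module _ {n m r : ℕ} (e : suc r ≡ n + m) (i : Fin n) where

        composeᴸ-𝟎 : (x : Combination (Basis n)) → composeᴸ e i x 𝟎 ≋ 𝟎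
        composeᴸ-𝟎 x = E.extend-𝟎 r x

        composeᴸ-⊕ : (x : Combination (Basis n)) (y y′ : Combination (Basis m)) →
                     composeᴸ e i x (y ⊕ y′) ≋ composeᴸ e i x y ⊕ composeᴸ e i x y′
        composeᴸ-⊕ x y y′ = E.extend-⊕ r _ _ x

        composeᴸ-⊖ : (x : Combination (Basis n)) (y : Combination (Basis m)) →
                     composeᴸ e i x (⊖ y) ≋ ⊖ composeᴸ e i x y
        composeᴸ-⊖ x y = E.extend-⊖ r _ x

        composeᴸ-⊙ : (k : 𝕂) (x : Combination (Basis n)) (y : Combination (Basis m)) →
                     composeᴸ e i x (k ⊙ y) ≋ k ⊙ composeᴸ e i x y
        composeᴸ-⊙ k x y = E.extend-⊙ r k _ x

      module _ {n m p a b r : ℕ} (e : suc a ≡ n + m) (f : suc r ≡ a + p)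
               (e′ : suc b ≡ n + p) (f′ : suc r ≡ b + m)
               (i j : Fin n) (k : Fin a) (i′ : Fin b)
               (i<j : i < j) (k≡ : suc (toℕ k) ≡ toℕ j + m) (i′≡ : toℕ i′ ≡ toℕ i) where

        par₃ : ∀ s t z → composeᴸ f k ⟨ compose e i s t ⟩ z ≋ composeᴸ f′ i′ (composeᴸ e′ j ⟨ s ⟩ z) ⟨ t ⟩
        par₃ s t ⟨ u ⟩   = lift (≡.trans
          (SetOperad.parallel P (proj₁ s) (toℕ i) (toℕ j) (proj₁ t) (proj₁ u) (toℕ k) i<j (input s j)
            (≡.trans k≡ (cong (toℕ j +_) (≡.sym (proj₂ t)))))
          (cong (λ l → graft (graft (proj₁ s) (toℕ j) (proj₁ u)) l (proj₁ t)) (≡.sym i′≡)))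
        par₃ s t 𝟎       = ≋-refl
        par₃ s t (x ⊕ y) = ⊕-cong (par₃ s t x) (par₃ s t y)
        par₃ s t (⊖ x)   = ⊖-cong (par₃ s t x)
        par₃ s t (l ⊙ x) = ⊙-cong K.refl (par₃ s t x)

        par₂ : ∀ s y z → composeᴸ f k (composeᴸ e i ⟨ s ⟩ y) z ≋ composeᴸ f′ i′ (composeᴸ e′ j ⟨ s ⟩ z) y
        par₂ s ⟨ t ⟩   z = par₃ s t z
        par₂ s 𝟎       z = ≋-sym (composeᴸ-𝟎 f′ i′ (composeᴸ e′ j ⟨ s ⟩ z))
        par₂ s (x ⊕ y) z = ≋-trans (⊕-cong (par₂ s x z) (par₂ s y z)) (≋-sym (composeᴸ-⊕ f′ i′ (composeᴸ e′ j ⟨ s ⟩ z) x y))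
        par₂ s (⊖ x)   z = ≋-trans (⊖-cong (par₂ s x z)) (≋-sym (composeᴸ-⊖ f′ i′ (composeᴸ e′ j ⟨ s ⟩ z) x))
        par₂ s (l ⊙ x) z = ≋-trans (⊙-cong K.refl (par₂ s x z)) (≋-sym (composeᴸ-⊙ f′ i′ l (composeᴸ e′ j ⟨ s ⟩ z) x))

        par : ∀ x y z → composeᴸ f k (composeᴸ e i x y) z ≋ composeᴸ f′ i′ (composeᴸ e′ j x z) y
        par ⟨ s ⟩    y z = par₂ s y z
        par 𝟎        y z = ≋-refl
        par (x ⊕ x′) y z = ⊕-cong (par x y z) (par x′ y z)
        par (⊖ x)    y z = ⊖-cong (par x y z)
        par (l ⊙ x)  y z = ⊙-cong K.refl (par x y z)

    operad : Operad (c ⊔ b) (c ⊔ ℓ₁ ⊔ b)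
    operad = record
      { component  = λ n → freeSpace (Basis n)
      ; one        = one
      ; comp       = composeᴸ
      ; comp-cong  = λ e i p q → E.extend₂-cong _ (λ s t → ⟨ compose e i s t ⟩) p q
      ; comp-+ˡ    = λ _ _ _ _ _ → ≋-refl
      ; comp-*ˡ    = λ _ _ _ _ _ → ≋-refl
      ; comp-+ʳ    = composeᴸ-⊕
      ; comp-*ʳ    = composeᴸ-⊙
      ; identityˡ  = idˡ
      ; identityʳ  = idʳ
      ; sequential = λ e f e′ f′ i j k x y z k≡ → seq e f e′ f′ i j k k≡ x y z
      ; parallel   = λ e f e′ f′ i j k i′ x y z i<j k≡ i′≡ → par e f e′ f′ i j k i′ i<j k≡ i′≡ x y z
      }

  linearise : ∀ {b} → SetOperad b → Operad (c ⊔ b) (c ⊔ ℓ₁ ⊔ b)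
  linearise P = Linearisation.operad P

  record Ideal {m ℓm : Level} (O : Operad m ℓm) (ℓ : Level) : Set (c ⊔ m ⊔ ℓm ⊔ lsuc ℓ) where
    open Operad O
    field
      part    : ∀ n → Subspace (O ⦅ n ⦆) ℓ
      closedˡ : ∀ {n m r} (e : suc r ≡ n + m) i {x y} → x ∈ part n → comp e i x y ∈ part r
      closedʳ : ∀ {n m r} (e : suc r ≡ n + m) i {x y} → y ∈ part m → comp e i x y ∈ part r

  quotient : ∀ {m ℓm ℓ} (O : Operad m ℓm) → Ideal O ℓ → Operad m ℓ
  quotient O I = record
    { component  = λ n → quotientSpace (O ⦅ n ⦆) (part n)
    ; one        = O.one
    ; comp       = O.comp
    ; comp-cong  = cong′
    ; comp-+ˡ    = λ e i x x′ y → from _ (O.comp-+ˡ e i x x′ y)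
    ; comp-*ˡ    = λ e i k x y → from _ (O.comp-*ˡ e i k x y)
    ; comp-+ʳ    = λ e i x y y′ → from _ (O.comp-+ʳ e i x y y′)
    ; comp-*ʳ    = λ e i k x y → from _ (O.comp-*ʳ e i k x y)
    ; identityˡ  = λ e x → from _ (O.identityˡ e x)
    ; identityʳ  = λ e i x → from _ (O.identityʳ e i x)
    ; sequential = λ e f e′ f′ i j k x y z k≡ → from _ (O.sequential e f e′ f′ i j k x y z k≡)
    ; parallel   = λ e f e′ f′ i j k i′ x y z i<j k≡ i′≡ → from _ (O.parallel e f e′ f′ i j k i′ x y z i<j k≡ i′≡)
    }
    where
    module O = Operad O
    module V n = SpaceLemmas (O ⦅ n ⦆)
    module Q n = LeftModule (quotientSpace (O ⦅ n ⦆) (Ideal.part I n))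
    open Ideal I
    from : ∀ n {x y} → V._≈ᴹ_ n x y → Q._≈ᴹ_ n x y
    from n p = Subspace.resp (part n) (V.≈ᴹ-sym n (V.x≈y⇒x∙y⁻¹≈ε n p)) (Subspace.0-closed (part n))
    cong′ : ∀ {n m r} (e : suc r ≡ n + m) (i : Fin n) {x x′ y y′} →
            Q._≈ᴹ_ n x x′ → Q._≈ᴹ_ m y y′ → Q._≈ᴹ_ r (O.comp e i x y) (O.comp e i x′ y′)
    cong′ {n} {m} {r} e i {x} {x′} {y} {y′} p q = Q.≈ᴹ-trans r
      (Subspace.resp (part r)
        (V.≈ᴹ-trans r (O.comp-+ˡ e i _ _ _) (V.+ᴹ-congˡ r (O.comp-neg e i _ _)))
        (closedˡ e i {y = y} p))
      (Subspace.resp (part r)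
        (V.≈ᴹ-trans r (O.comp-+ʳ e i _ _ _) (V.+ᴹ-congˡ r (O.comp-negʳ e i _ _)))
        (closedʳ e i {x = x′} q))

  module _ {m ℓm ℓ : Level} (O : Operad m ℓm) {k : ℕ} (R : Subspace (O ⦅ k ⦆) ℓ) where
    open Operad O
    private module V n = LeftModule (O ⦅ n ⦆)

    data Generated : ∀ n → Pred ∣ O ⦅ n ⦆ ∣ (c ⊔ m ⊔ ℓm ⊔ ℓ) where
      relation : ∀ {x} → x ∈ R → Generated k x
      ≈-in     : ∀ {n x y} → V._≈ᴹ_ n x y → Generated n x → Generated n y
      0-in     : ∀ {n} → Generated n (V.0ᴹ n)
      +-in     : ∀ {n x y} → Generated n x → Generated n y → Generated n (V._+ᴹ_ n x y)
      *-in     : ∀ {n} l {x} → Generated n x → Generated n (V._*ₗ_ n l x)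
      comp-inˡ : ∀ {n m r} (e : suc r ≡ n + m) i {x y} → Generated n x → Generated r (comp e i x y)
      comp-inʳ : ∀ {n m r} (e : suc r ≡ n + m) i {x y} → Generated m y → Generated r (comp e i x y)

    idealGeneratedBy : Ideal O (c ⊔ m ⊔ ℓm ⊔ ℓ)
    idealGeneratedBy = record
      { part    = λ n → record
        { Member = Generated n ; resp = ≈-in ; 0-closed = 0-in ; +-closed = +-in ; *-closed = *-in }
      ; closedˡ = comp-inˡ
      ; closedʳ = comp-inʳ
      }

  record OperadIsomorphism {m ℓm m′ ℓm′ : Level} (O : Operad m ℓm) (P : Operad m′ ℓm′)
                           : Set (c ⊔ m ⊔ ℓm ⊔ m′ ⊔ ℓm′) where
    private
      module O = Operad O
      module P = Operad P
    field
      to       : ∀ {n} → ∣ O ⦅ n ⦆ ∣ → ∣ P ⦅ n ⦆ ∣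
      isLinear : ∀ n → LeftModuleMorphisms.IsLeftModuleIsomorphism
                   (LeftModule.rawLeftModule (O ⦅ n ⦆)) (LeftModule.rawLeftModule (P ⦅ n ⦆)) (to {n})
      to-one   : to O.one P.≈ᴹ P.one
      to-comp  : ∀ {n m r} (e : suc r ≡ n + m) (i : Fin n) x y →
                 to (O.comp e i x y) P.≈ᴹ P.comp e i (to x) (to y)

  Free : ∀ {g} → Set g → Operad (c ⊔ g) (c ⊔ ℓ₁ ⊔ g)
  Free G = linearise (Trees.setOperad G)

  generator : ∀ {g} {G : Set g} → G → ∣ Free G ⦅ 2 ⦆ ∣
  generator x = ⟨ node x leaf leaf , refl ⟩

  infix 9 _∘₁_ _∘₂_
  _∘₁_ _∘₂_ : ∀ {g} {G : Set g} → G → G → ∣ Free G ⦅ 3 ⦆ ∣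
  _∘₁_ {G = G} x y = Operad.comp (Free G) refl zero (generator x) (generator y)
  _∘₂_ {G = G} x y = Operad.comp (Free G) refl (suc zero) (generator x) (generator y)

  QuadraticSpace : ∀ {g} → Set g → (ℓ : Level) → Set (c ⊔ ℓ₁ ⊔ g ⊔ lsuc ℓ)
  QuadraticSpace G ℓ = Subspace (Free G ⦅ 3 ⦆) ℓ

  Free/⟨_⟩ : ∀ {g ℓ} {G : Set g} → QuadraticSpace G ℓ → Operad (c ⊔ g) (c ⊔ ℓ₁ ⊔ g ⊔ ℓ)
  Free/⟨_⟩ {G = G} R = quotient (Free G) (idealGeneratedBy (Free G) R)

  IsPresentedBy : ∀ {m ℓm g ℓ} → Operad m ℓm → (G : Set g) → QuadraticSpace G ℓ →
                  Set (c ⊔ ℓ₁ ⊔ m ⊔ ℓm ⊔ g ⊔ ℓ)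
  IsPresentedBy O G R = OperadIsomorphism Free/⟨ R ⟩ O

  record QuadraticPresentation {m ℓm : Level} (O : Operad m ℓm) (g ℓ : Level)
                               : Set (c ⊔ ℓ₁ ⊔ m ⊔ ℓm ⊔ lsuc (g ⊔ ℓ)) where
    field
      Generator   : Set g
      _≟_         : DecidableEquality Generator
      Relations   : QuadraticSpace Generator ℓ
      isPresented : IsPresentedBy O Generator Relations

  module Orthogonality {g : Level} {G : Set g} (_≟_ : DecidableEquality G) where

    -- The first two clauses are  ⟨ x ∘₁ y , x′ ∘₁ y′ ⟩  and  ⟨ x ∘₂ y , x′ ∘₂ y′ ⟩.
    treeForm : Tree G → Tree G → 𝕂
    treeForm (node x (node y leaf leaf) leaf) (node x′ (node y′ leaf leaf) leaf) =
      if does (x ≟ x′) ∧ does (y ≟ y′) then K.1# else K.0#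
    treeForm (node x leaf (node y leaf leaf)) (node x′ leaf (node y′ leaf leaf)) =
      if does (x ≟ x′) ∧ does (y ≟ y′) then K.- K.1# else K.0#
    treeForm _ _ = K.0#

    form : ∣ Free G ⦅ 3 ⦆ ∣ → ∣ Free G ⦅ 3 ⦆ ∣ → 𝕂
    form = extend₂ scalars λ s t → treeForm (proj₁ s) (proj₁ t)

    annihilator : ∀ {ℓ} → QuadraticSpace G ℓ → QuadraticSpace G (c ⊔ ℓ₁ ⊔ g ⊔ ℓ)
    annihilator R = record
      { Member   = λ y → ∀ x → x ∈ R → form x y K.≈ K.0#
      ; resp     = λ y≈y′ p x x∈R → K.trans (E.extend₂-cong β (≋-refl {x = x}) (≋-sym y≈y′)) (p x x∈R)
      ; 0-closed = λ x _ → E.extend-𝟎 x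
      ; +-closed = λ {y} {y′} p q x x∈R →
          K.trans (E.extend-⊕ (λ s → E.extend (β s) y) (λ s → E.extend (β s) y′) x)
            (K.trans (K.+-cong (p x x∈R) (q x x∈R)) (K.+-identityˡ K.0#))
      ; *-closed = λ k {y} p x x∈R →
          K.trans (E.extend-⊙ k (λ s → E.extend (β s) y) x)
            (K.trans (K.*-congˡ (p x x∈R)) (K.zeroʳ k))
      }
      where
      module E = Extension scalars
      β : Linearisation.Basis (Trees.setOperad G) 3 → Linearisation.Basis (Trees.setOperad G) 3 → 𝕂
      β s t = treeForm (proj₁ s) (proj₁ t)

  koszulDual : ∀ {m ℓm g ℓ} {O : Operad m ℓm} → QuadraticPresentation O g ℓ →
               Operad (c ⊔ g) (c ⊔ ℓ₁ ⊔ g ⊔ ℓ)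
  koszulDual P = Free/⟨ Orthogonality.annihilator _≟_ Relations ⟩
    where open QuadraticPresentation P

  Dias : (γ : ℕ) → Operad c (c ⊔ ℓ₁)
  Dias γ = linearise (Words.setOperad γ)

  infixl 6 _-ᶠ_
  _-ᶠ_ : ∀ {b} {B : Set b} → Combination B → Combination B → Combination B
  x -ᶠ y = x ⊕ ⊖ y

  data DiasRelator (γ : ℕ) : Pred ∣ Free (DiasGenerator γ) ⦅ 3 ⦆ ∣ c where
    ⊣⊢ : ∀ a a′ → DiasRelator γ (⊣ a ∘₁ ⊢ a′        -ᶠ ⊢ a′ ∘₂ ⊣ a)
    ⊣₂ : ∀ a a′ → DiasRelator γ (⊣ a ∘₁ ⊣ (a ↑ a′)  -ᶠ ⊣ a ∘₂ ⊢ a′)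
    ⊢₂ : ∀ a a′ → DiasRelator γ (⊢ a ∘₁ ⊣ a′        -ᶠ ⊢ a ∘₂ ⊢ (a ↑ a′))
    ⊣⊣ : ∀ a a′ → DiasRelator γ (⊣ (a ↑ a′) ∘₁ ⊣ a  -ᶠ ⊣ a ∘₂ ⊣ a′)
    ⊢⊢ : ∀ a a′ → DiasRelator γ (⊢ a ∘₁ ⊢ a′        -ᶠ ⊢ (a ↑ a′) ∘₂ ⊢ a)

  DiasRelations : (γ : ℕ) → QuadraticSpace (DiasGenerator γ) (c ⊔ ℓ₁)
  DiasRelations γ = span (DiasRelator γ)

  -- The sum of f a over all a ∈ [d].
  ∑[_] : ∀ {γ b} {B : Set b} → Fin γ → (Fin γ → Combination B) → Combination B
  ∑[_] {γ} d f = foldr (λ a x → f a ⊕ x) 𝟎 (filter (_≤? d) (allFin γ))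

  data DendrRelator (γ : ℕ) : Pred ∣ Free (DendrGenerator γ) ⦅ 3 ⦆ ∣ c where
    ↼⇀  : ∀ a a′ → DendrRelator γ (↼ a ∘₁ ⇀ a′ -ᶠ ⇀ a′ ∘₂ ↼ a)
    ↼<₁ : ∀ a b → a < b → DendrRelator γ (↼ a ∘₁ ↼ b -ᶠ ↼ a ∘₂ ⇀ b)
    ⇀<₁ : ∀ a b → a < b → DendrRelator γ (⇀ a ∘₁ ↼ b -ᶠ ⇀ a ∘₂ ⇀ b)
    ↼<₂ : ∀ a b → a < b → DendrRelator γ (↼ b ∘₁ ↼ a -ᶠ ↼ a ∘₂ ↼ b)
    ⇀<₂ : ∀ a b → a < b → DendrRelator γ (⇀ a ∘₁ ⇀ b -ᶠ ⇀ b ∘₂ ⇀ a)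
    ↼∑  : ∀ d → DendrRelator γ (↼ d ∘₁ ↼ d -ᶠ ∑[ d ] (λ a → ↼ d ∘₂ ↼ a ⊕ ↼ d ∘₂ ⇀ a))
    ⇀∑  : ∀ d → DendrRelator γ (∑[ d ] (λ a → ⇀ d ∘₁ ⇀ a ⊕ ⇀ d ∘₁ ↼ a) -ᶠ ⇀ d ∘₂ ⇀ d)

  DendrRelations : (γ : ℕ) → QuadraticSpace (DendrGenerator γ) (c ⊔ ℓ₁)
  DendrRelations γ = span (DendrRelator γ)

  _≟ᴰ_ : ∀ {γ} → DecidableEquality (DiasGenerator γ)
  (⊣ a) ≟ᴰ (⊣ b) = map′ (cong ⊣_) (λ { refl → refl }) (a Fin.≟ b)
  (⊣ a) ≟ᴰ (⊢ b) = no λ ()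
  (⊢ a) ≟ᴰ (⊣ b) = no λ ()
  (⊢ a) ≟ᴰ (⊢ b) = map′ (cong ⊢_) (λ { refl → refl }) (a Fin.≟ b)

  module DiasPresentation (γ : ℕ) where
    open Words γ using (Word; word≡)
    open Evaluation γ
    open Trees (DiasGenerator γ) using (leaves; graft-right′)

    private
      F D : Operad c (c ⊔ ℓ₁)
      F = Free (DiasGenerator γ)
      D = Dias γ
      module F = Operad F
      module D = Operad D
      module LF = Linearisation (Trees.setOperad (DiasGenerator γ))
      module LD = Linearisation (Words.setOperad γ)
      module VF n = SpaceLemmas (F ⦅ n ⦆)
      module VD n = SpaceLemmas (D ⦅ n ⦆)
      module ED n = Extension (D ⦅ n ⦆)
      module EF n = Extension (F ⦅ n ⦆)
      I : Ideal F (c ⊔ ℓ₁)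
      I = idealGeneratedBy F (DiasRelations γ)
      Q : Operad c (c ⊔ ℓ₁)
      Q = Free/⟨ DiasRelations γ ⟩
      module VQ n = SpaceLemmas (Q ⦅ n ⦆)

      fromF : ∀ n {x y} → VF._≈ᴹ_ n x y → VQ._≈ᴹ_ n x y
      fromF n p = ≈-in (VF.≈ᴹ-sym n (VF.x≈y⇒x∙y⁻¹≈ε n p)) 0-in

    word-of : ∀ {n} → LF.Basis n → LD.Basis n
    word-of (t , p) = evaluate t , ≡.trans (length-letters t) p

    tree-of : ∀ {n} → LD.Basis n → LF.Basis n
    tree-of (w , p) = normal (proj₁ w) , ≡.trans (leaves-normal w) p

    to : ∀ {n} → ∣ F ⦅ n ⦆ ∣ → ∣ D ⦅ n ⦆ ∣
    to {n} = extend (D ⦅ n ⦆) λ s → ⟨ word-of s ⟩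

    back : ∀ {n} → ∣ D ⦅ n ⦆ ∣ → ∣ F ⦅ n ⦆ ∣
    back {n} = extend (F ⦅ n ⦆) λ s → ⟨ tree-of s ⟩

    module _ {n m r : ℕ} (e : suc r ≡ n + m) (i : Fin n) where

      to-comp₁ : ∀ s (y : ∣ F ⦅ m ⦆ ∣) → to (F.comp {n} {m} e i ⟨ s ⟩ y) ≋ D.comp {n} {m} e i ⟨ word-of s ⟩ (to y)
      to-comp₁ s ⟨ t ⟩    = LD.lift (word≡ (≡.trans (letters-graft (proj₁ s) (toℕ i) (proj₁ t) (LF.input s i))
        (≡.sym (Words.insert-letters γ (evaluate (proj₁ s)) (toℕ i) (evaluate (proj₁ t)) (LD.input (word-of s) i)))))
      to-comp₁ s 𝟎        = ≋-refl
      to-comp₁ s (y ⊕ y′) = ⊕-cong (to-comp₁ s y) (to-comp₁ s y′)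
      to-comp₁ s (⊖ y)    = ⊖-cong (to-comp₁ s y)
      to-comp₁ s (k ⊙ y)  = ⊙-cong K.refl (to-comp₁ s y)

      to-comp : ∀ (x : ∣ F ⦅ n ⦆ ∣) (y : ∣ F ⦅ m ⦆ ∣) → to (F.comp {n} {m} e i x y) ≋ D.comp {n} {m} e i (to x) (to y)
      to-comp ⟨ s ⟩    y = to-comp₁ s y
      to-comp 𝟎        y = ≋-refl
      to-comp (x ⊕ x′) y = ⊕-cong (to-comp x y) (to-comp x′ y)
      to-comp (⊖ x)    y = ⊖-cong (to-comp x y)
      to-comp (k ⊙ x)  y = ⊙-cong K.refl (to-comp x y)

    rule-relator : ∀ {g h g′ h′} → Rule g h g′ h′ → DiasRelator γ (g ∘₁ h -ᶠ g′ ∘₂ h′)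
    rule-relator (⊣⊢ a b) = ⊣⊢ a b
    rule-relator (⊣₂ a b) = ⊣₂ a b
    rule-relator (⊢₂ a b) = ⊢₂ a b
    rule-relator (⊣⊣ a b) = ⊣⊣ a b
    rule-relator (⊢⊢ a b) = ⊢⊢ a b

    private
      to-rule : ∀ {g h g′ h′} → Rule g h g′ h′ → to {3} (g ∘₁ h -ᶠ g′ ∘₂ h′) ≋ 𝟎
      to-rule ρ = VD.x≈y⇒x∙y⁻¹≈ε 3 (LD.lift (word≡ (~letters ρ)))

      to-relator : ∀ {x} → DiasRelator γ x → to {3} x ≋ 𝟎
      to-relator (⊣⊢ a b) = to-rule (⊣⊢ a b)
      to-relator (⊣₂ a b) = to-rule (⊣₂ a b)
      to-relator (⊢₂ a b) = to-rule (⊢₂ a b)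
      to-relator (⊣⊣ a b) = to-rule (⊣⊣ a b)
      to-relator (⊢⊢ a b) = to-rule (⊢⊢ a b)

      to-relation : ∀ {x} → x ∈ DiasRelations γ → to {3} x ≋ 𝟎
      to-relation (member p) = to-relator p
      to-relation (≈-in x≈y p) = ≋-trans (ED.extend-cong 3 _ (≋-sym x≈y)) (to-relation p)
      to-relation 0-in = ≋-refl
      to-relation (+-in p q) = ≋-trans (⊕-cong (to-relation p) (to-relation q)) (⊕-identityˡ 𝟎)
      to-relation (*-in k p) = ≋-trans (⊙-cong K.refl (to-relation p)) (⊙-zeroʳ k)

      to-ideal : ∀ {n x} → x ∈ Ideal.part I n → to {n} x ≋ 𝟎
      to-ideal (relation p) = to-relation p
      to-ideal {n} (≈-in x≈y p) = ≋-trans (ED.extend-cong n _ (≋-sym x≈y)) (to-ideal p)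
      to-ideal 0-in = ≋-refl
      to-ideal (+-in p q) = ≋-trans (⊕-cong (to-ideal p) (to-ideal q)) (⊕-identityˡ 𝟎)
      to-ideal (*-in k p) = ≋-trans (⊙-cong K.refl (to-ideal p)) (⊙-zeroʳ k)
      to-ideal (comp-inˡ {n} {m} {r} e i {x} {y} p) =
        ≋-trans (to-comp {n} {m} e i x y)
          (D.comp-cong {n} {m} e i {x = to x} {x′ = 𝟎} {y = to y} (to-ideal p) ≋-refl)
      to-ideal (comp-inʳ {n} {m} {r} e i {x} {y} p) =
        ≋-trans (to-comp {n} {m} e i x y)
          (≋-trans (D.comp-cong {n} {m} e i {x = to x} {y = to y} {y′ = 𝟎} ≋-refl (to-ideal p)) (ED.extend-𝟎 r (to x)))

      to-cong : ∀ {n} {x y : ∣ Q ⦅ n ⦆ ∣} → VQ._≈ᴹ_ n x y → to x ≋ to y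
      to-cong {n} {x} {y} p = VD.x∙y⁻¹≈ε⇒x≈y n (to x) (to y) (to-ideal p)

      node-congˡ : ∀ g {l l′} r {n} (p : leaves l + leaves r ≡ n) (p′ : leaves l′ + leaves r ≡ n) →
                   (∀ {m} (q : leaves l ≡ m) (q′ : leaves l′ ≡ m) → VQ._≈ᴹ_ m ⟨ l , q ⟩ ⟨ l′ , q′ ⟩) →
                   VQ._≈ᴹ_ n ⟨ node g l r , p ⟩ ⟨ node g l′ r , p′ ⟩
      node-congˡ g {l} {l′} r {n} p p′ h =
        ≈-in (⊕-cong (LF.lift refl) (⊖-cong (LF.lift refl)))
          (comp-inʳ {n = suc (leaves r)} {m = leaves l} e zero {x = ⟨ node g leaf r , refl ⟩}
            (h refl l′≡))
        where
        l′≡ : leaves l′ ≡ leaves l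
        l′≡ = ℕ.+-cancelʳ-≡ (leaves r) _ _ (≡.trans p′ (≡.sym p))
        e : suc n ≡ suc (leaves r) + leaves l
        e = cong suc (≡.trans (≡.sym p) (ℕ.+-comm (leaves l) (leaves r)))

      node-congʳ : ∀ g l {r r′} {n} (p : leaves l + leaves r ≡ n) (p′ : leaves l + leaves r′ ≡ n) →
                   (∀ {m} (q : leaves r ≡ m) (q′ : leaves r′ ≡ m) → VQ._≈ᴹ_ m ⟨ r , q ⟩ ⟨ r′ , q′ ⟩) →
                   VQ._≈ᴹ_ n ⟨ node g l r , p ⟩ ⟨ node g l r′ , p′ ⟩
      node-congʳ g l {r} {r′} {n} p p′ h =
        ≈-in (⊕-cong (LF.lift (graft-last r)) (⊖-cong (LF.lift (graft-last r′))))
          (comp-inʳ {n = suc (leaves l)} {m = leaves r} e (fromℕ (leaves l)) {x = ⟨ node g l leaf , ℕ.+-comm (leaves l) 1 ⟩}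
            (h refl r′≡))
        where
        r′≡ : leaves r′ ≡ leaves r
        r′≡ = ℕ.+-cancelˡ-≡ (leaves l) _ _ (≡.trans p′ (≡.sym p))
        e : suc n ≡ suc (leaves l) + leaves r
        e = cong suc (≡.sym p)
        graft-last : ∀ s → Trees.graft (DiasGenerator γ) (node g l leaf) (toℕ (fromℕ (leaves l))) s ≡ node g l s
        graft-last s = graft-right′ g l leaf 0 s (toℕ (fromℕ (leaves l)))
          (≡.trans (Fin.toℕ-fromℕ (leaves l)) (≡.sym (ℕ.+-identityʳ (leaves l))))

      rule-in : ∀ {g h g′ h′} → Rule g h g′ h′ → ∀ x y z {n} p p′ →
                VQ._≈ᴹ_ n ⟨ node g (node h x y) z , p ⟩ ⟨ node g′ x (node h′ y z) , p′ ⟩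
      rule-in ρ x y z {n} p p′ =
        ≈-in (⊕-cong (LF.lift refl) (⊖-cong (LF.lift refl)))
          (comp-inˡ {n = suc (leaves z + leaves y)} {m = leaves x} e zero {y = ⟨ x , refl ⟩}
          (comp-inˡ {n = suc (suc (leaves z))} {m = leaves y} refl (suc zero) {y = ⟨ y , refl ⟩}
          (comp-inˡ {n = 3} {m = leaves z} refl (suc (suc zero)) {y = ⟨ z , refl ⟩}
          (relation (member (rule-relator ρ))))))
        where
        e : suc n ≡ suc (leaves z + leaves y) + leaves x
        e = cong suc (≡.trans (≡.sym p)
              (≡.trans (ℕ.+-comm (leaves x + leaves y) (leaves z))
              (≡.trans (cong (leaves z +_) (ℕ.+-comm (leaves x) (leaves y)))
                       (≡.sym (ℕ.+-assoc (leaves z) (leaves y) (leaves x))))))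

      ~sound : ∀ {t s} → t ~ s → ∀ {n} (p : leaves t ≡ n) (q : leaves s ≡ n) → VQ._≈ᴹ_ n ⟨ t , p ⟩ ⟨ s , q ⟩
      ~sound ~refl        {n} p q = fromF n (LF.lift refl)
      ~sound (~sym h)     {n} p q = VQ.≈ᴹ-sym n (~sound h q p)
      ~sound (~trans h k) {n} p q = VQ.≈ᴹ-trans n (~sound h p s≡) (~sound k s≡ q)
        where s≡ = ≡.trans (≡.sym (~leaves h)) p
      ~sound (~node g {l} {l′} {r} {r′} h k) {n} p q =
        VQ.≈ᴹ-trans n (node-congˡ g r p m≡ (~sound h)) (node-congʳ g l′ m≡ q (~sound k))
        where
        m≡ : leaves l′ + leaves r ≡ n
        m≡ = ≡.trans (cong (_+ leaves r) (≡.sym (~leaves h))) p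
      ~sound (~rule ρ x y z) p q = rule-in ρ x y z p q

      back-to : ∀ {n} (x : ∣ F ⦅ n ⦆ ∣) → VQ._≈ᴹ_ n x (back (to x))
      back-to {n} ⟨ t , p ⟩ = ~sound (~normal t) p _
      back-to {n} 𝟎         = VQ.≈ᴹ-refl n
      back-to {n} (x ⊕ y)   = VQ.+ᴹ-cong n {x} {back (to x)} {y} {back (to y)} (back-to x) (back-to y)
      back-to {n} (⊖ x)     = VQ.-ᴹ‿cong n {x} {back (to x)} (back-to x)
      back-to {n} (k ⊙ x)   = VQ.*ₗ-congˡ n {k} {x} {back (to x)} (back-to x)

      to-back : ∀ {n} (x : ∣ D ⦅ n ⦆ ∣) → to {n} (back x) ≋ x
      to-back ⟨ w , p ⟩ = LD.lift (evaluate-normal w)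
      to-back 𝟎         = ≋-refl
      to-back (x ⊕ y)   = ⊕-cong (to-back x) (to-back y)
      to-back (⊖ x)     = ⊖-cong (to-back x)
      to-back (k ⊙ x)   = ⊙-cong K.refl (to-back x)

      to-injective : ∀ {n} (x y : ∣ F ⦅ n ⦆ ∣) → to {n} x ≋ to y → VQ._≈ᴹ_ n x y
      to-injective {n} x y p =
        VQ.≈ᴹ-trans n {x} {back (to x)} {y} (back-to x)
          (VQ.≈ᴹ-trans n {back (to x)} {back (to y)} {y} (fromF n (EF.extend-cong n _ p))
            (VQ.≈ᴹ-sym n {y} {back (to y)} (back-to y)))

    isPresented : IsPresentedBy D (DiasGenerator γ) (DiasRelations γ)
    isPresented = record
      { to       = λ {n} → to {n}
      ; isLinear = λ n → record
        { isLeftModuleMonomorphism = record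
          { isLeftModuleHomomorphism = record
            { +ᴹ-isGroupHomomorphism = record
              { isMonoidHomomorphism = record
                { isMagmaHomomorphism = record
                  { isRelHomomorphism = record { cong = λ {x} {y} → to-cong {n} {x} {y} }
                  ; homo = λ _ _ → ≋-refl
                  }
                ; ε-homo = ≋-refl
                }
              ; ⁻¹-homo = λ _ → ≋-refl
              }
            ; *ₗ-homo = λ _ _ → ≋-refl
            }
          ; injective = λ {x} {y} → to-injective {n} x y
          }
        ; surjective = λ y → back y , λ {z} z≈ → ≋-trans (to-cong {n} {z} {back y} z≈) (to-back y)
        }
      ; to-one   = LD.lift (word≡ refl)
      ; to-comp  = to-comp
      }

  diasPresentation : (γ : ℕ) → QuadraticPresentation (Dias γ) Level.zero (c ⊔ ℓ₁)
  diasPresentation γ = record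
    { Generator   = DiasGenerator γ
    ; _≟_         = _≟ᴰ_
    ; Relations   = DiasRelations γ
    ; isPresented = DiasPresentation.isPresented γ
    }

  Dendr : (γ : ℕ) → Operad c (c ⊔ ℓ₁)
  Dendr γ = koszulDual (diasPresentation γ)

{-# OPTIONS --safe #-}
-- The trees with three leaves over the generators of Dias fall into classes according to the word they
-- evaluate to, and the relations of Dias are spanned by the differences t − t′ within a class, where t has
-- the shape ∘₁ and t′ the shape ∘₂.  As the form takes opposite signs on the two shapes, an element is
-- orthogonal to all of these when its coefficients on t and t′ are opposite in every class.  Each class
-- has a single tree of one of the two shapes, so the annihilator has a basis with one element per class:
-- that tree, minus the sum of the trees of the other shape.  For the words 0ba and ab0 the latter sum has
-- one term if a ≠ b and runs over [a] if a = b, which gives the relators ↼<₁, ↼<₂, ↼∑ and ⇀<₁, ⇀<₂, ⇀∑;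
-- the words a0b give ↼⇀.
module Submission where

open import Defs
open import Level using (Level; _⊔_)
open import Algebra.Apartness.Bundles using (HeytingField; HeytingCommutativeRing)
open import Algebra.Bundles using (CommutativeRing)
open import Algebra.Module.Bundles using (LeftModule)
import Algebra.Properties.CommutativeMonoid.Sum as CommutativeMonoidSum
open import Data.Bool using (Bool; true; false; if_then_else_; _∧_)
open import Data.Bool.Properties using (∧-comm)
open import Data.Fin using (Fin; zero; suc; toℕ; _<_; _≤_; _≟_; _≤?_)
import Data.Fin.Properties as Fin
open import Data.List using (foldr; filter; tabulate)
open import Data.Nat as ℕ using (ℕ; suc; _+_; _∸_)
import Data.Nat.Properties as ℕ
open import Data.Product using (Σ; _×_; _,_; proj₁)
open import Function using (_∘_; _⇔_; mk⇔; id)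
open import Relation.Binary.Definitions using (tri<; tri≈; tri>)
open import Relation.Binary.PropositionalEquality as ≡ using (_≡_; refl; cong; cong₂)
open import Relation.Nullary using (¬_; Dec; yes; no; does; contradiction)
open import Relation.Nullary.Decidable using (does-⇔; dec-false)
open import Relation.Unary using (Pred; Decidable)

private
  variable
    n : ℕ
    g h : Level
    G : Set g
    H : Set h

-- Relabelling the nodes of planar binary trees.

mapTree : (G → H) → Tree G → Tree H
mapTree f leaf         = leaf
mapTree f (node x l r) = node (f x) (mapTree f l) (mapTree f r)

leaves-mapTree : ∀ (f : G → H) t → Trees.leaves H (mapTree f t) ≡ Trees.leaves G t
leaves-mapTree f leaf         = refl
leaves-mapTree f (node x l r) = cong₂ _+_ (leaves-mapTree f l) (leaves-mapTree f r)

-- The two sides branch on separate comparisons, with the leaves of `l` before and after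
-- relabelling; these numbers agree, so the mixed branches are contradictory.
mapTree-graft : ∀ (f : G → H) t i s → mapTree f (Trees.graft G t i s) ≡ Trees.graft H (mapTree f t) i (mapTree f s)
mapTree-graft f leaf i s = refl
mapTree-graft {G = G} {H = H} f (node x l r) i s
  with i ℕ.<? Trees.leaves G l | i ℕ.<? Trees.leaves H (mapTree f l)
... | yes _   | yes _   = cong (λ l′ → node (f x) l′ (mapTree f r)) (mapTree-graft f l i s)
... | yes i<l | no  i≮l = contradiction (≡.subst (i ℕ.<_) (≡.sym (leaves-mapTree f l)) i<l) i≮l
... | no  i≮l | yes i<l = contradiction (≡.subst (i ℕ.<_) (leaves-mapTree f l) i<l) i≮l
... | no  _   | no  _   = cong (node (f x) (mapTree f l)) (≡.trans
  (mapTree-graft f r (i ∸ Trees.leaves G l) s)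
  (cong (λ k → Trees.graft H (mapTree f r) (i ∸ k) (mapTree f s)) (≡.sym (leaves-mapTree f l))))

mapTree-inverse : ∀ (f : G → H) (f⁻¹ : H → G) → (∀ x → f⁻¹ (f x) ≡ x) → ∀ t → mapTree f⁻¹ (mapTree f t) ≡ t
mapTree-inverse f f⁻¹ inv leaf = refl
mapTree-inverse f f⁻¹ inv (node x l r)
  rewrite inv x | mapTree-inverse f f⁻¹ inv l | mapTree-inverse f f⁻¹ inv r = refl

-- Fibres of the maximum on `Fin n`.

≤-↑ : ∀ (a b : Fin n) → a ≤ a ↑ b
≤-↑ zero    b       = ℕ.z≤n
≤-↑ (suc a) zero    = ℕ.≤-refl
≤-↑ (suc a) (suc b) = ℕ.s≤s (≤-↑ a b)

<⇒↑≡ : ∀ {a b : Fin n} → a < b → a ↑ b ≡ b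
<⇒↑≡ {a = zero}              _           = refl
<⇒↑≡ {a = suc a} {b = suc b} (ℕ.s≤s a<b) = cong suc (<⇒↑≡ a<b)

-- A maximum above `a` can only come from `x`; so the fibre of `a ↑_` over `b` contains at most `b`.
<⇒↑-injective : ∀ {a b : Fin n} x → a < b → a ↑ x ≡ b → b ≡ x
<⇒↑-injective {a = zero}  x       _           p = ≡.sym p
<⇒↑-injective {a = suc a} zero    a<b         p = contradiction a<b (Fin.<-irrefl p)
<⇒↑-injective {a = suc a} (suc x) (ℕ.s≤s a<b) refl = cong suc (<⇒↑-injective x a<b refl)

<⇒↑≢ : ∀ {a b : Fin n} x → a < b → ¬ (b ↑ x ≡ a)
<⇒↑≢ {b = b} x a<b refl = ℕ.<⇒≱ a<b (≤-↑ b x)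

-- The source of the ranges `[d]`: the partner trees in the class of a repeated letter `d` are those
-- with `d ↑ x ≡ d`.
↑-absorbs⇔≤ : ∀ (d x : Fin n) → (d ↑ x ≡ d) ⇔ (x ≤ d)
↑-absorbs⇔≤ d x = mk⇔ (λ p → ≡.subst (x ≤_) (≡.trans (↑-comm x d) p) (≤-↑ x d)) (from d x)
  where
  from : ∀ {n} (d x : Fin n) → x ≤ d → d ↑ x ≡ d
  from zero    zero    _           = refl
  from (suc d) zero    _           = refl
  from (suc d) (suc x) (ℕ.s≤s x≤d) = cong suc (from d x x≤d)

-- Trees with three leaves.

data Quadratic {g} {G : Set g} : Tree G → Set g where
  inner₁ : ∀ x y → Quadratic (node x (node y leaf leaf) leaf)
  inner₂ : ∀ x y → Quadratic (node x leaf (node y leaf leaf))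

module _ {g : Level} {G : Set g} where

  open Trees G using (leaves)

  1≤leaves : ∀ t → 1 ℕ.≤ leaves t
  1≤leaves leaf         = ℕ.≤-refl
  1≤leaves (node x l r) = ℕ.≤-trans (1≤leaves l) (ℕ.m≤m+n _ _)

  2≤leaves : ∀ x l r → 2 ℕ.≤ leaves (node x l r)
  2≤leaves x l r = ℕ.+-mono-≤ (1≤leaves l) (1≤leaves r)

  -- A tree outside the two shapes either has fewer than three leaves, which the equation excludes
  -- by computation, or at least four, by the lower bounds on its subtrees.
  quadratic : ∀ t → leaves t ≡ 3 → Quadratic t
  quadratic (node x (node y leaf leaf) leaf) _ = inner₁ x y
  quadratic (node x leaf (node y leaf leaf)) _ = inner₂ x y
  quadratic (node x leaf (node y (node z l m) r)) p = contradiction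
    (ℕ.+-monoʳ-≤ 1 (ℕ.+-mono-≤ (2≤leaves z l m) (1≤leaves r))) (ℕ.<⇒≱ (ℕ.s≤s (ℕ.≤-reflexive p)))
  quadratic (node x leaf (node y leaf (node z m r))) p = contradiction
    (ℕ.+-monoʳ-≤ 2 (2≤leaves z m r)) (ℕ.<⇒≱ (ℕ.s≤s (ℕ.≤-reflexive p)))
  quadratic (node x (node y (node z l m) r) leaf) p = contradiction
    (ℕ.+-mono-≤ (ℕ.+-mono-≤ (2≤leaves z l m) (1≤leaves r)) ℕ.≤-refl) (ℕ.<⇒≱ (ℕ.s≤s (ℕ.≤-reflexive p)))
  quadratic (node x (node y leaf (node z m r)) leaf) p = contradiction
    (ℕ.+-mono-≤ (ℕ.+-monoʳ-≤ 1 (2≤leaves z m r)) (ℕ.≤-refl {1})) (ℕ.<⇒≱ (ℕ.s≤s (ℕ.≤-reflexive p)))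
  quadratic (node x (node y k l) (node z m r)) p = contradiction
    (ℕ.+-mono-≤ (2≤leaves y k l) (2≤leaves z m r)) (ℕ.<⇒≱ (ℕ.s≤s (ℕ.≤-reflexive p)))

-- Koszul duality keeps the generating set, so `Dendr` is a quotient of the free operad on
-- `DiasGenerator`; this bijection leads there from the generators of the stated presentation.
dual : ∀ {γ} → DendrGenerator γ → DiasGenerator γ
dual (↼ a) = ⊣ a
dual (⇀ a) = ⊢ a

dual⁻¹ : ∀ {γ} → DiasGenerator γ → DendrGenerator γ
dual⁻¹ (⊣ a) = ↼ a
dual⁻¹ (⊢ a) = ⇀ a

dual⁻¹-dual : ∀ {γ} (x : DendrGenerator γ) → dual⁻¹ (dual x) ≡ x
dual⁻¹-dual (↼ a) = refl
dual⁻¹-dual (⇀ a) = refl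

dual-dual⁻¹ : ∀ {γ} (x : DiasGenerator γ) → dual (dual⁻¹ x) ≡ x
dual-dual⁻¹ (⊣ a) = refl
dual-dual⁻¹ (⊢ a) = refl

module _ {c ℓ₁ ℓ₂ : Level} (K : HeytingField c ℓ₁ ℓ₂) where

  open Over K

  private
    module K = CommutativeRing (HeytingCommutativeRing.commutativeRing (HeytingField.heytingCommutativeRing K))

  -- Free operads and their quadratic quotients under a change of generators.

  module Relabelling {g h : Level} {G : Set g} {H : Set h} (f : G → H) where

    private
      module LG = Linearisation (Trees.setOperad G)
      module LH = Linearisation (Trees.setOperad H)

    mapBasis : ∀ {n} → LG.Basis n → LH.Basis n
    mapBasis (t , p) = mapTree f t , ≡.trans (leaves-mapTree f t) p

    relabel : ∀ {n} → ∣ Free G ⦅ n ⦆ ∣ → ∣ Free H ⦅ n ⦆ ∣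
    relabel {n} = Extension.extend (Free H ⦅ n ⦆) λ s → ⟨ mapBasis s ⟩

    relabel-cong : ∀ {n} {x y : ∣ Free G ⦅ n ⦆ ∣} → x ≋ y → relabel x ≋ relabel y
    relabel-cong {n} = Extension.extend-cong (Free H ⦅ n ⦆) _

    -- Moves a linear map back along the relabelling; it serves to compute values of the form on
    -- trees over `DendrGenerator`.
    extend-relabel : ∀ {m ℓm} (V : Space m ℓm) {n} (φ : LH.Basis n → ∣ V ∣) x →
                     LeftModule._≈ᴹ_ V (Extension.extend V φ (relabel x)) (Extension.extend V (λ s → φ (mapBasis s)) x)
    extend-relabel V φ = go
      where
      open LeftModule V
      go : ∀ x → Extension.extend V φ (relabel x) ≈ᴹ Extension.extend V (λ s → φ (mapBasis s)) x
      go ⟨ s ⟩   = ≈ᴹ-refl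
      go 𝟎       = ≈ᴹ-refl
      go (x ⊕ y) = +ᴹ-cong (go x) (go y)
      go (⊖ x)   = -ᴹ‿cong (go x)
      go (k ⊙ x) = *ₗ-cong K.refl (go x)

    module _ {n m r : ℕ} (e : suc r ≡ n + m) (i : Fin n) where

      private
        comp₁ : ∀ s (y : ∣ Free G ⦅ m ⦆ ∣) →
                relabel (LG.composeᴸ e i ⟨ s ⟩ y) ≋ LH.composeᴸ e i ⟨ mapBasis s ⟩ (relabel y)
        comp₁ s ⟨ t ⟩   = LH.lift (mapTree-graft f (proj₁ s) (toℕ i) (proj₁ t))
        comp₁ s 𝟎       = ≋-refl
        comp₁ s (x ⊕ y) = ⊕-cong (comp₁ s x) (comp₁ s y)
        comp₁ s (⊖ x)   = ⊖-cong (comp₁ s x)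
        comp₁ s (k ⊙ x) = ⊙-cong K.refl (comp₁ s x)

      relabel-comp : ∀ (x : ∣ Free G ⦅ n ⦆ ∣) (y : ∣ Free G ⦅ m ⦆ ∣) →
                     relabel (LG.composeᴸ e i x y) ≋ LH.composeᴸ e i (relabel x) (relabel y)
      relabel-comp ⟨ s ⟩    y = comp₁ s y
      relabel-comp 𝟎        y = ≋-refl
      relabel-comp (x ⊕ x′) y = ⊕-cong (relabel-comp x y) (relabel-comp x′ y)
      relabel-comp (⊖ x)    y = ⊖-cong (relabel-comp x y)
      relabel-comp (k ⊙ x)  y = ⊙-cong K.refl (relabel-comp x y)

    module _ {ℓ ℓ′ : Level} (R : QuadraticSpace G ℓ) (S : QuadraticSpace H ℓ′)
             (R⇒S : ∀ x → x ∈ R → relabel x ∈ S) where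

      -- Relabelling commutes with partial composition, so each step generating the ideal of `R` is
      -- carried to the same step for `S`.
      relabel-ideal : ∀ {n x} → Generated (Free G) R n x → Generated (Free H) S n (relabel x)
      relabel-ideal (relation p) = relation (R⇒S _ p)
      relabel-ideal (≈-in x≈y p) = ≈-in (relabel-cong x≈y) (relabel-ideal p)
      relabel-ideal 0-in         = 0-in
      relabel-ideal (+-in p q)   = +-in (relabel-ideal p) (relabel-ideal q)
      relabel-ideal (*-in l p)   = *-in l (relabel-ideal p)
      relabel-ideal (comp-inˡ e i {x} {y} p) =
        ≈-in (≋-sym (relabel-comp e i x y)) (comp-inˡ e i {y = relabel y} (relabel-ideal p))
      relabel-ideal (comp-inʳ e i {x} {y} p) =
        ≈-in (≋-sym (relabel-comp e i x y)) (comp-inʳ e i {x = relabel x} (relabel-ideal p))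

  module _ {g h : Level} {G : Set g} {H : Set h} (f : G → H) (f⁻¹ : H → G) (inverse : ∀ x → f⁻¹ (f x) ≡ x) where

    open Relabelling

    relabel-inverse : ∀ {n} (x : ∣ Free G ⦅ n ⦆ ∣) → relabel f⁻¹ (relabel f x) ≋ x
    relabel-inverse ⟨ s ⟩   = Linearisation.lift (Trees.setOperad G) (mapTree-inverse f f⁻¹ inverse (proj₁ s))
    relabel-inverse 𝟎       = ≋-refl
    relabel-inverse (x ⊕ y) = ⊕-cong (relabel-inverse x) (relabel-inverse y)
    relabel-inverse (⊖ x)   = ⊖-cong (relabel-inverse x)
    relabel-inverse (k ⊙ x) = ⊙-cong K.refl (relabel-inverse x)

  module _ {g h ℓ ℓ′ : Level} {G : Set g} {H : Set h} (f : G → H) (f⁻¹ : H → G)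
           (inverseˡ : ∀ x → f⁻¹ (f x) ≡ x) (inverseʳ : ∀ y → f (f⁻¹ y) ≡ y)
           {R : QuadraticSpace G ℓ} {S : QuadraticSpace H ℓ′} where

    open Relabelling

    private
      module QS n = SpaceLemmas (Free/⟨ S ⟩ ⦅ n ⦆)

    -- Comparing the relations in arity 3 suffices: `f` carries the ideal of `R` into that of `S`,
    -- and injectivity on the quotients follows by carrying the ideal of `S` back along `f⁻¹`.
    relabel-isomorphism : (∀ x → x ∈ R → relabel f x ∈ S) → (∀ x → relabel f x ∈ S → x ∈ R) →
                          OperadIsomorphism Free/⟨ R ⟩ Free/⟨ S ⟩
    relabel-isomorphism R⇒S S⇒R = record
      { to       = relabel f
      ; isLinear = λ n → record
        { isLeftModuleMonomorphism = record
          { isLeftModuleHomomorphism = record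
            { +ᴹ-isGroupHomomorphism = record
              { isMonoidHomomorphism = record
                { isMagmaHomomorphism = record
                  { isRelHomomorphism = record { cong = relabel-ideal f R S R⇒S }
                  ; homo = λ x y → QS.≈ᴹ-refl n {relabel f (x ⊕ y)}
                  }
                ; ε-homo = QS.≈ᴹ-refl n {𝟎}
                }
              ; ⁻¹-homo = λ x → QS.≈ᴹ-refl n {⊖ relabel f x}
              }
            ; *ₗ-homo = λ k x → QS.≈ᴹ-refl n {k ⊙ relabel f x}
            }
          ; injective = λ {x} {y} p →
              ≈-in (⊕-cong (relabel-inverse f f⁻¹ inverseˡ x) (⊖-cong (relabel-inverse f f⁻¹ inverseˡ y)))
                (relabel-ideal f⁻¹ S R S⇒R′ p)
          }
        ; surjective = λ y → relabel f⁻¹ y , λ {z} p →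
            ≈-in (⊕-cong (≋-refl {x = relabel f z}) (⊖-cong (relabel-inverse f⁻¹ f inverseʳ y)))
              (relabel-ideal f R S R⇒S p)
        }
      ; to-one   = QS.≈ᴹ-refl 1 {Operad.one (Free H)}
      ; to-comp  = λ {n} {m} {r} e i x y →
          ≈-in (≋-sym (SpaceLemmas.x≈y⇒x∙y⁻¹≈ε (Free H ⦅ r ⦆) (relabel-comp f e i x y))) 0-in
      }
      where
      S⇒R′ : ∀ y → y ∈ S → relabel f⁻¹ y ∈ R
      -- The hypothesis speaks of elements `relabel f x` only; up to `≋` every `y` is of this form.
      S⇒R′ y p = S⇒R (relabel f⁻¹ y) (Subspace.resp S (≋-sym (relabel-inverse f⁻¹ f inverseʳ y)) p)

  -- Finite sums in a space and their regrouping by classes of trees.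

  module Sums {m ℓm : Level} (V : Space m ℓm) where

    open SpaceLemmas V
    open CommutativeMonoidSum +ᴹ-commutativeMonoid public
      using (sum; sum-cong-≋; ∑-distrib-+; ∑-comm; sum-replicate-zero)

    infix 8 [_]_
    -- The Iverson bracket: a sum over a subset becomes a sum over all of `Fin n`, so that
    -- summations can be interchanged.
    [_]_ : Bool → ∣ V ∣ → ∣ V ∣
    [ b ] x = if b then x else 0ᴹ

    []-cong : ∀ b {x y} → x ≈ᴹ y → [ b ] x ≈ᴹ [ b ] y
    []-cong true  p = p
    []-cong false p = ≈ᴹ-refl

    []-congᵇ : ∀ {b b′} x → b ≡ b′ → [ b ] x ≈ᴹ [ b′ ] x
    []-congᵇ x p = ≈ᴹ-reflexive (cong ([_] x) p)

    []-zero : ∀ b → [ b ] 0ᴹ ≈ᴹ 0ᴹ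
    []-zero true  = ≈ᴹ-refl
    []-zero false = ≈ᴹ-refl

    []-∧ : ∀ b b′ x → [ b ∧ b′ ] x ≈ᴹ [ b ] ([ b′ ] x)
    []-∧ true  b′ x = ≈ᴹ-refl
    []-∧ false b′ x = ≈ᴹ-refl

    []-comm : ∀ b b′ x → [ b ] ([ b′ ] x) ≈ᴹ [ b′ ] ([ b ] x)
    []-comm true  b′ x = ≈ᴹ-refl
    []-comm false b′ x = ≈ᴹ-sym ([]-zero b′)

    []-*ₗ : ∀ b k x → k *ₗ [ b ] x ≈ᴹ [ b ] (k *ₗ x)
    []-*ₗ true  k x = ≈ᴹ-refl
    []-*ₗ false k x = *ₗ-zeroʳ k

    sum-zero : {F : Fin n → ∣ V ∣} → (∀ i → F i ≈ᴹ 0ᴹ) → sum F ≈ᴹ 0ᴹ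
    sum-zero {n} p = ≈ᴹ-trans (sum-cong-≋ p) (sum-replicate-zero n)

    sum-*ₗ : ∀ k (F : Fin n → ∣ V ∣) → k *ₗ sum F ≈ᴹ sum (λ i → k *ₗ F i)
    sum-*ₗ {ℕ.zero} k F = *ₗ-zeroʳ k
    sum-*ₗ {suc n}  k F = ≈ᴹ-trans (*ₗ-distribˡ k _ _) (+ᴹ-congˡ (sum-*ₗ k (F ∘ suc)))

    sum-≟ : ∀ (b : Fin n) (F : Fin n → ∣ V ∣) → sum (λ i → [ does (b ≟ i) ] F i) ≈ᴹ F b
    sum-≟ {suc n} zero F = ≈ᴹ-trans (+ᴹ-congˡ (sum-replicate-zero n)) (+ᴹ-identityʳ _)
    sum-≟ (suc b)      F = ≈ᴹ-trans (+ᴹ-identityˡ _) (sum-≟ b (F ∘ suc))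

    sum-singleton : ∀ {p} {P : Fin n → Set p} (P? : Decidable P) (b : Fin n) → (∀ i → P i ⇔ (b ≡ i)) →
                    (F : Fin n → ∣ V ∣) → sum (λ i → [ does (P? i) ] F i) ≈ᴹ F b
    sum-singleton P? b P⇔≡ F =
      ≈ᴹ-trans (sum-cong-≋ λ i → []-congᵇ (F i) (does-⇔ (P⇔≡ i) (P? i) (b ≟ i))) (sum-≟ b F)

    sum-empty : ∀ {p} {P : Fin n → Set p} (P? : Decidable P) → (∀ i → ¬ P i) →
                (F : Fin n → ∣ V ∣) → sum (λ i → [ does (P? i) ] F i) ≈ᴹ 0ᴹ
    sum-empty P? ¬P F = sum-zero λ i → []-congᵇ (F i) (dec-false (P? i) (¬P i))

    module _ {γ : ℕ} where

      -- The word 0ba is the value of the tree ⊣a ∘₁ ⊣b and of the trees ⊣a ∘₂ ⊢i with a ↑ i = b and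
      -- ⊣b ∘₂ ⊣i with b ↑ i = a; the word ab0 is that of ⊢a ∘₂ ⊢b and of the trees ⊢a ∘₁ ⊣i with
      -- a ↑ i = b and ⊢b ∘₁ ⊢i with b ↑ i = a.
      fibreSum : (f g : Fin γ → Fin γ → ∣ V ∣) → Fin γ → Fin γ → ∣ V ∣
      fibreSum f g a b = sum (λ i → [ does (a ↑ i ≟ b) ] f a i) +ᴹ sum (λ i → [ does (b ↑ i ≟ a) ] g b i)

      fibreSum-cong : ∀ {f f′ g g′} → (∀ a i → f a i ≈ᴹ f′ a i) → (∀ b i → g b i ≈ᴹ g′ b i) →
                      ∀ a b → fibreSum f g a b ≈ᴹ fibreSum f′ g′ a b
      fibreSum-cong f≈ g≈ a b = +ᴹ-cong (sum-cong-≋ λ i → []-cong (does (a ↑ i ≟ b)) (f≈ a i))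
                                        (sum-cong-≋ λ i → []-cong (does (b ↑ i ≟ a)) (g≈ b i))

      fibreSum-comm : ∀ f g a b → fibreSum f g a b ≈ᴹ fibreSum g f b a
      fibreSum-comm f g a b = +ᴹ-comm _ _

      fibreSum-zero : ∀ {f g} → (∀ a i → f a i ≈ᴹ 0ᴹ) → (∀ b i → g b i ≈ᴹ 0ᴹ) → ∀ a b → fibreSum f g a b ≈ᴹ 0ᴹ
      fibreSum-zero f≈ g≈ a b = ≈ᴹ-trans
        (+ᴹ-cong (sum-zero λ i → ≈ᴹ-trans ([]-cong (does (a ↑ i ≟ b)) (f≈ a i)) ([]-zero (does (a ↑ i ≟ b))))
                 (sum-zero λ i → ≈ᴹ-trans ([]-cong (does (b ↑ i ≟ a)) (g≈ b i)) ([]-zero (does (b ↑ i ≟ a)))))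
        (+ᴹ-identityˡ 0ᴹ)

      -- When `a < b`, `a ↑ i ≡ b` forces `i ≡ b` and `b ↑ i ≡ a` is impossible. The one remaining
      -- term gives the two-term relators.
      fibreSum-< : ∀ f g {a b} → a < b → fibreSum f g a b ≈ᴹ f a b
      fibreSum-< f g {a} {b} a<b = ≈ᴹ-trans
        (+ᴹ-cong (sum-singleton (λ i → a ↑ i ≟ b) b
                   (λ i → mk⇔ (<⇒↑-injective i a<b) λ { refl → <⇒↑≡ a<b }) (f a))
                 (sum-empty (λ i → b ↑ i ≟ a) (λ i → <⇒↑≢ i a<b) (g b)))
        (+ᴹ-identityʳ _)

      fibreSum-> : ∀ f g {a b} → a < b → fibreSum f g b a ≈ᴹ g a b
      fibreSum-> f g {a} {b} a<b = ≈ᴹ-trans (fibreSum-comm f g b a) (fibreSum-< g f a<b)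

      -- On the diagonal both conditions become `i ≤ d`. The two families are swapped to match the
      -- order of the summands in `↼∑` and `⇀∑`.
      fibreSum-≡ : ∀ f g d → fibreSum f g d d ≈ᴹ sum (λ i → [ does (i ≤? d) ] (g d i +ᴹ f d i))
      fibreSum-≡ f g d = begin
        sum (λ i → [ does (d ↑ i ≟ d) ] f d i) +ᴹ sum (λ i → [ does (d ↑ i ≟ d) ] g d i)
          ≈⟨ +ᴹ-comm _ _ ⟩
        sum (λ i → [ does (d ↑ i ≟ d) ] g d i) +ᴹ sum (λ i → [ does (d ↑ i ≟ d) ] f d i)
          ≈⟨ ∑-distrib-+ (λ i → [ does (d ↑ i ≟ d) ] g d i) (λ i → [ does (d ↑ i ≟ d) ] f d i) ⟨
        sum (λ i → [ does (d ↑ i ≟ d) ] g d i +ᴹ [ does (d ↑ i ≟ d) ] f d i)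
          ≈⟨ sum-cong-≋ (λ i → ≈ᴹ-trans ([]-+ (does (d ↑ i ≟ d)) (g d i) (f d i))
               ([]-congᵇ _ (does-⇔ (↑-absorbs⇔≤ d i) (d ↑ i ≟ d) (i ≤? d)))) ⟩
        sum (λ i → [ does (i ≤? d) ] (g d i +ᴹ f d i)) ∎
        where
        []-+ : ∀ b x y → [ b ] x +ᴹ [ b ] y ≈ᴹ [ b ] (x +ᴹ y)
        []-+ true  x y = ≈ᴹ-refl
        []-+ false x y = +ᴹ-identityˡ 0ᴹ

      -- The first family is supported at the single tree `(a′, b′)`, which lies in the class of the
      -- pair `(a′, a′ ↑ b′)` alone.
      fibreSum-δˡ : ∀ a′ b′ x a b → fibreSum (λ a i → [ does (a′ ≟ a) ∧ does (b′ ≟ i) ] x) (λ _ _ → 0ᴹ) a b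
                                    ≈ᴹ [ does (a′ ≟ a) ∧ does (a′ ↑ b′ ≟ b) ] x
      fibreSum-δˡ a′ b′ x a b = begin
        fibreSum (λ a i → [ does (a′ ≟ a) ∧ does (b′ ≟ i) ] x) (λ _ _ → 0ᴹ) a b
          ≈⟨ +ᴹ-cong (sum-cong-≋ λ i → swap (does (a ↑ i ≟ b)) (does (b′ ≟ i)))
                     (sum-zero λ i → []-zero (does (b ↑ i ≟ a))) ⟩
        sum (λ i → [ does (b′ ≟ i) ] ([ does (a′ ≟ a) ] ([ does (a ↑ i ≟ b) ] x))) +ᴹ 0ᴹ
          ≈⟨ +ᴹ-identityʳ _ ⟩
        sum (λ i → [ does (b′ ≟ i) ] ([ does (a′ ≟ a) ] ([ does (a ↑ i ≟ b) ] x)))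
          ≈⟨ sum-≟ b′ _ ⟩
        [ does (a′ ≟ a) ] ([ does (a ↑ b′ ≟ b) ] x)
          ≈⟨ subst-a (a′ ≟ a) ⟩
        [ does (a′ ≟ a) ] ([ does (a′ ↑ b′ ≟ b) ] x)
          ≈⟨ []-∧ (does (a′ ≟ a)) (does (a′ ↑ b′ ≟ b)) x ⟨
        [ does (a′ ≟ a) ∧ does (a′ ↑ b′ ≟ b) ] x ∎
        where
        swap : ∀ p q → [ p ] ([ does (a′ ≟ a) ∧ q ] x) ≈ᴹ [ q ] ([ does (a′ ≟ a) ] ([ p ] x))
        swap p q = begin
          [ p ] ([ does (a′ ≟ a) ∧ q ] x)       ≈⟨ []-cong p ([]-∧ (does (a′ ≟ a)) q x) ⟩
          [ p ] ([ does (a′ ≟ a) ] ([ q ] x))   ≈⟨ []-comm p (does (a′ ≟ a)) _ ⟩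
          [ does (a′ ≟ a) ] ([ p ] ([ q ] x))   ≈⟨ []-cong (does (a′ ≟ a)) ([]-comm p q x) ⟩
          [ does (a′ ≟ a) ] ([ q ] ([ p ] x))   ≈⟨ []-comm (does (a′ ≟ a)) q _ ⟩
          [ q ] ([ does (a′ ≟ a) ] ([ p ] x))   ∎
        subst-a : (a≟ : Dec (a′ ≡ a)) → [ does a≟ ] ([ does (a ↑ b′ ≟ b) ] x) ≈ᴹ [ does a≟ ] ([ does (a′ ↑ b′ ≟ b) ] x)
        subst-a (yes refl) = ≈ᴹ-refl
        subst-a (no _)     = ≈ᴹ-refl

      -- The mirror case: in the second family, the tree `(a′, b′)` lies in the class of
      -- `(a′ ↑ b′, a′)`.
      fibreSum-δʳ : ∀ a′ b′ x a b → fibreSum (λ _ _ → 0ᴹ) (λ b i → [ does (a′ ≟ b) ∧ does (b′ ≟ i) ] x) a b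
                                    ≈ᴹ [ does (a′ ↑ b′ ≟ a) ∧ does (a′ ≟ b) ] x
      fibreSum-δʳ a′ b′ x a b = begin
        fibreSum (λ _ _ → 0ᴹ) (λ b i → [ does (a′ ≟ b) ∧ does (b′ ≟ i) ] x) a b
          ≈⟨ +ᴹ-comm _ _ ⟩
        fibreSum (λ b i → [ does (a′ ≟ b) ∧ does (b′ ≟ i) ] x) (λ _ _ → 0ᴹ) b a
          ≈⟨ fibreSum-δˡ a′ b′ x b a ⟩
        [ does (a′ ≟ b) ∧ does (a′ ↑ b′ ≟ a) ] x
          ≈⟨ []-congᵇ x (∧-comm (does (a′ ≟ b)) (does (a′ ↑ b′ ≟ a))) ⟩
        [ does (a′ ↑ b′ ≟ a) ∧ does (a′ ≟ b) ] x ∎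

      sum₂ : (Fin γ → Fin γ → ∣ V ∣) → ∣ V ∣
      sum₂ F = sum λ a → sum (F a)

      sum₂-cong : ∀ {F F′} → (∀ a b → F a b ≈ᴹ F′ a b) → sum₂ F ≈ᴹ sum₂ F′
      sum₂-cong p = sum-cong-≋ λ a → sum-cong-≋ (p a)

      sum₂-+ : ∀ F F′ → sum₂ (λ a b → F a b +ᴹ F′ a b) ≈ᴹ sum₂ F +ᴹ sum₂ F′
      sum₂-+ F F′ = ≈ᴹ-trans (sum-cong-≋ λ a → ∑-distrib-+ (F a) (F′ a)) (∑-distrib-+ (λ a → sum (F a)) (λ a → sum (F′ a)))

      -- Double counting: every tree of the two families occurs in exactly one class, so it receives
      -- the weight `φ` of that class.
      sum₂-fibreSum : ∀ (φ : Fin γ → Fin γ → K.Carrier) f g →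
        sum₂ (λ a b → φ a b *ₗ fibreSum f g a b) ≈ᴹ
        sum₂ (λ a i → φ a (a ↑ i) *ₗ f a i) +ᴹ sum₂ (λ b i → φ (b ↑ i) b *ₗ g b i)
      sum₂-fibreSum φ f g = begin
        sum₂ (λ a b → φ a b *ₗ fibreSum f g a b)
          ≈⟨ sum₂-cong (λ a b → *ₗ-distribˡ (φ a b) _ _) ⟩
        sum₂ (λ a b → φ a b *ₗ sum (λ i → [ does (a ↑ i ≟ b) ] f a i) +ᴹ φ a b *ₗ sum (λ i → [ does (b ↑ i ≟ a) ] g b i))
          ≈⟨ sum₂-+ _ _ ⟩
        sum₂ (λ a b → φ a b *ₗ sum (λ i → [ does (a ↑ i ≟ b) ] f a i)) +ᴹ
        sum₂ (λ a b → φ a b *ₗ sum (λ i → [ does (b ↑ i ≟ a) ] g b i))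
          ≈⟨ +ᴹ-cong (sum-cong-≋ λ a → collapse (φ a) (a ↑_) (f a))
                     -- In the second family the index kept by a tree is `b`, so the sums are
                     -- interchanged before collapsing over `a`.
                     (≈ᴹ-trans (∑-comm {γ} {γ} λ a b → φ a b *ₗ sum (λ i → [ does (b ↑ i ≟ a) ] g b i))
                       (sum-cong-≋ λ b → collapse (λ a → φ a b) (b ↑_) (g b))) ⟩
        sum₂ (λ a i → φ a (a ↑ i) *ₗ f a i) +ᴹ sum₂ (λ b i → φ (b ↑ i) b *ₗ g b i) ∎
        where
        collapse : ∀ (ψ : Fin γ → K.Carrier) (u : Fin γ → Fin γ) (F : Fin γ → ∣ V ∣) →
                   sum (λ b → ψ b *ₗ sum (λ i → [ does (u i ≟ b) ] F i)) ≈ᴹ sum (λ i → ψ (u i) *ₗ F i)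
        collapse ψ u F = begin
          sum (λ b → ψ b *ₗ sum (λ i → [ does (u i ≟ b) ] F i))
            ≈⟨ sum-cong-≋ (λ b → ≈ᴹ-trans (sum-*ₗ (ψ b) (λ i → [ does (u i ≟ b) ] F i))
                 (sum-cong-≋ λ i → []-*ₗ (does (u i ≟ b)) (ψ b) (F i))) ⟩
          sum (λ b → sum (λ i → [ does (u i ≟ b) ] (ψ b *ₗ F i)))
            ≈⟨ ∑-comm {γ} {γ} (λ b i → [ does (u i ≟ b) ] (ψ b *ₗ F i)) ⟩
          sum (λ i → sum (λ b → [ does (u i ≟ b) ] (ψ b *ₗ F i)))
            ≈⟨ sum-cong-≋ (λ i → sum-≟ (u i) (λ b → ψ b *ₗ F i)) ⟩
          sum (λ i → ψ (u i) *ₗ F i) ∎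

      sumᴳ : (DiasGenerator γ → ∣ V ∣) → ∣ V ∣
      sumᴳ F = sum (λ a → F (⊣ a)) +ᴹ sum (λ a → F (⊢ a))

      sumᴳ-cong : ∀ {F F′} → (∀ g → F g ≈ᴹ F′ g) → sumᴳ F ≈ᴹ sumᴳ F′
      sumᴳ-cong p = +ᴹ-cong (sum-cong-≋ λ a → p (⊣ a)) (sum-cong-≋ λ a → p (⊢ a))

      sumᴳ-zero : ∀ {F} → (∀ g → F g ≈ᴹ 0ᴹ) → sumᴳ F ≈ᴹ 0ᴹ
      sumᴳ-zero p = ≈ᴹ-trans (+ᴹ-cong (sum-zero λ a → p (⊣ a)) (sum-zero λ a → p (⊢ a))) (+ᴹ-identityˡ 0ᴹ)

      sumᴳ-+ : ∀ F F′ → sumᴳ (λ g → F g +ᴹ F′ g) ≈ᴹ sumᴳ F +ᴹ sumᴳ F′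
      sumᴳ-+ F F′ = ≈ᴹ-trans (+ᴹ-cong (∑-distrib-+ (F ∘ ⊣_) (F′ ∘ ⊣_)) (∑-distrib-+ (F ∘ ⊢_) (F′ ∘ ⊢_)))
                             (interchange _ _ _ _)

      sumᴳ-*ₗ : ∀ k F → k *ₗ sumᴳ F ≈ᴹ sumᴳ (λ g → k *ₗ F g)
      sumᴳ-*ₗ k F = ≈ᴹ-trans (*ₗ-distribˡ k _ _) (+ᴹ-cong (sum-*ₗ k (F ∘ ⊣_)) (sum-*ₗ k (F ∘ ⊢_)))

      sumᴳ-≟ : ∀ g₀ (F : DiasGenerator γ → ∣ V ∣) → sumᴳ (λ g → [ does (g ≟ᴰ g₀) ] F g) ≈ᴹ F g₀
      sumᴳ-≟ (⊣ b) F = ≈ᴹ-trans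
        (+ᴹ-cong (sum-singleton (_≟ b) b (λ i → mk⇔ ≡.sym ≡.sym) (F ∘ ⊣_)) (sum-replicate-zero γ))
        (+ᴹ-identityʳ _)
      sumᴳ-≟ (⊢ b) F = ≈ᴹ-trans
        (+ᴹ-cong (sum-replicate-zero γ) (sum-singleton (_≟ b) b (λ i → mk⇔ ≡.sym ≡.sym) (F ∘ ⊢_)))
        (+ᴹ-identityˡ _)

      -- Meant for the trees of one shape, `g` being the root label and `h` the inner one; `t` is
      -- arbitrary so that the trees may also be read in a quotient.
      combination : (DiasGenerator γ → DiasGenerator γ → K.Carrier) → (DiasGenerator γ → DiasGenerator γ → ∣ V ∣) → ∣ V ∣
      combination k t = sumᴳ λ g → sumᴳ λ h → k g h *ₗ t g h

      combination-zero : ∀ {k} t → (∀ g h → k g h K.≈ K.0#) → combination k t ≈ᴹ 0ᴹ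
      combination-zero t p = sumᴳ-zero λ g → sumᴳ-zero λ h → ≈ᴹ-trans (*ₗ-congʳ (p g h)) (*ₗ-zeroˡ (t g h))

      combination-+ : ∀ k l t → combination (λ g h → k g h K.+ l g h) t ≈ᴹ combination k t +ᴹ combination l t
      combination-+ k l t = ≈ᴹ-trans
        (sumᴳ-cong λ g → ≈ᴹ-trans (sumᴳ-cong λ h → *ₗ-distribʳ (t g h) (k g h) (l g h))
                                  (sumᴳ-+ (λ h → k g h *ₗ t g h) (λ h → l g h *ₗ t g h)))
        (sumᴳ-+ (λ g → sumᴳ λ h → k g h *ₗ t g h) (λ g → sumᴳ λ h → l g h *ₗ t g h))

      combination-* : ∀ m k t → combination (λ g h → m K.* k g h) t ≈ᴹ m *ₗ combination k t
      combination-* m k t = ≈ᴹ-sym (≈ᴹ-trans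
        (sumᴳ-*ₗ m (λ g → sumᴳ λ h → k g h *ₗ t g h))
        (sumᴳ-cong λ g → ≈ᴹ-trans (sumᴳ-*ₗ m (λ h → k g h *ₗ t g h))
                                  (sumᴳ-cong λ h → ≈ᴹ-sym (*ₗ-assoc m (k g h) (t g h)))))

      combination-neg : ∀ k t → combination (λ g h → K.- k g h) t ≈ᴹ -ᴹ combination k t
      combination-neg k t = inverseʳ-unique _ _ (≈ᴹ-trans
        (≈ᴹ-sym (combination-+ k (λ g h → K.- k g h) t))
        (combination-zero t λ g h → K.-‿inverseʳ (k g h)))

      combination-≟ : ∀ g₀ h₀ m t →
                      combination (λ g h → if does (g ≟ᴰ g₀) ∧ does (h ≟ᴰ h₀) then m else K.0#) t ≈ᴹ m *ₗ t g₀ h₀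
      combination-≟ g₀ h₀ m t = begin
        combination (λ g h → if does (g ≟ᴰ g₀) ∧ does (h ≟ᴰ h₀) then m else K.0#) t
          ≈⟨ sumᴳ-cong (λ g → sumᴳ-cong (λ h → if-*ₗ (does (g ≟ᴰ g₀)) (does (h ≟ᴰ h₀)) (t g h))) ⟩
        sumᴳ (λ g → sumᴳ (λ h → [ does (h ≟ᴰ h₀) ] ([ does (g ≟ᴰ g₀) ] (m *ₗ t g h))))
          ≈⟨ sumᴳ-cong (λ g → sumᴳ-≟ h₀ (λ h → [ does (g ≟ᴰ g₀) ] (m *ₗ t g h))) ⟩
        sumᴳ (λ g → [ does (g ≟ᴰ g₀) ] (m *ₗ t g h₀))
          ≈⟨ sumᴳ-≟ g₀ (λ g → m *ₗ t g h₀) ⟩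
        m *ₗ t g₀ h₀ ∎
        where
        if-*ₗ : ∀ b b′ x → (if b ∧ b′ then m else K.0#) *ₗ x ≈ᴹ [ b′ ] ([ b ] (m *ₗ x))
        if-*ₗ true  true  x = ≈ᴹ-refl
        if-*ₗ true  false x = *ₗ-zeroˡ x
        if-*ₗ false b′    x = ≈ᴹ-trans (*ₗ-zeroˡ x) (≈ᴹ-sym ([]-zero b′))

      combination-blocks : ∀ k t → combination k t ≈ᴹ
        (sum₂ (λ a b → k (⊣ a) (⊣ b) *ₗ t (⊣ a) (⊣ b)) +ᴹ sum₂ (λ a b → k (⊣ a) (⊢ b) *ₗ t (⊣ a) (⊢ b))) +ᴹ
        (sum₂ (λ a b → k (⊢ a) (⊣ b) *ₗ t (⊢ a) (⊣ b)) +ᴹ sum₂ (λ a b → k (⊢ a) (⊢ b) *ₗ t (⊢ a) (⊢ b)))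
      combination-blocks k t = +ᴹ-cong
        (∑-distrib-+ (λ a → sum λ b → k (⊣ a) (⊣ b) *ₗ t (⊣ a) (⊣ b)) (λ a → sum λ b → k (⊣ a) (⊢ b) *ₗ t (⊣ a) (⊢ b)))
        (∑-distrib-+ (λ a → sum λ b → k (⊢ a) (⊣ b) *ₗ t (⊢ a) (⊣ b)) (λ a → sum λ b → k (⊢ a) (⊢ b) *ₗ t (⊢ a) (⊢ b)))

      open Evaluation γ using (Rule; ⊣⊢; ⊣₂; ⊢₂; ⊣⊣; ⊢⊢)

      -- The three equations express the lone tree of each class as the sum of its partners.
      -- Coefficients agree along rules, hence throughout each class, and regrouping by class turns
      -- one combination into the other. It is applied in the quotient by `DendrRelations`, where
      -- the equations hold.
      combination-balance : ∀ k₁ k₂ t₁ t₂ →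
        (∀ a b → t₁ (⊣ a) (⊣ b) ≈ᴹ fibreSum (λ a i → t₂ (⊣ a) (⊢ i)) (λ b i → t₂ (⊣ b) (⊣ i)) a b) →
        (∀ a b → t₁ (⊣ a) (⊢ b) ≈ᴹ t₂ (⊢ b) (⊣ a)) →
        (∀ a b → t₂ (⊢ a) (⊢ b) ≈ᴹ fibreSum (λ a i → t₁ (⊢ a) (⊣ i)) (λ b i → t₁ (⊢ b) (⊢ i)) a b) →
        (∀ {g h g′ h′} → Rule g h g′ h′ → k₁ g h K.≈ k₂ g′ h′) →
        combination k₁ t₁ ≈ᴹ combination k₂ t₂
      combination-balance k₁ k₂ t₁ t₂ left middle right k₁≈k₂ = begin
        combination k₁ t₁
          ≈⟨ combination-blocks k₁ t₁ ⟩
        (sum₂ (λ a b → k₁ (⊣ a) (⊣ b) *ₗ t₁ (⊣ a) (⊣ b)) +ᴹ sum₂ (λ a b → k₁ (⊣ a) (⊢ b) *ₗ t₁ (⊣ a) (⊢ b))) +ᴹ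
        (sum₂ (λ a b → k₁ (⊢ a) (⊣ b) *ₗ t₁ (⊢ a) (⊣ b)) +ᴹ sum₂ (λ a b → k₁ (⊢ a) (⊢ b) *ₗ t₁ (⊢ a) (⊢ b)))
          ≈⟨ +ᴹ-cong (+ᴹ-cong leftBlocks middleBlocks) rightBlocks ⟩
        ((⊣⊢₂ +ᴹ ⊣⊣₂) +ᴹ ⊢⊣₂) +ᴹ ⊢⊢₂
          ≈⟨ +ᴹ-assoc _ _ _ ⟩
        (⊣⊢₂ +ᴹ ⊣⊣₂) +ᴹ (⊢⊣₂ +ᴹ ⊢⊢₂)
          ≈⟨ +ᴹ-congʳ (+ᴹ-comm ⊣⊢₂ ⊣⊣₂) ⟩
        (⊣⊣₂ +ᴹ ⊣⊢₂) +ᴹ (⊢⊣₂ +ᴹ ⊢⊢₂)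
          ≈⟨ combination-blocks k₂ t₂ ⟨
        combination k₂ t₂ ∎
        where
        ⊣⊣₂ ⊣⊢₂ ⊢⊣₂ ⊢⊢₂ : ∣ V ∣
        ⊣⊣₂ = sum₂ λ a b → k₂ (⊣ a) (⊣ b) *ₗ t₂ (⊣ a) (⊣ b)
        ⊣⊢₂ = sum₂ λ a b → k₂ (⊣ a) (⊢ b) *ₗ t₂ (⊣ a) (⊢ b)
        ⊢⊣₂ = sum₂ λ a b → k₂ (⊢ a) (⊣ b) *ₗ t₂ (⊢ a) (⊣ b)
        ⊢⊢₂ = sum₂ λ a b → k₂ (⊢ a) (⊢ b) *ₗ t₂ (⊢ a) (⊢ b)
        leftBlocks : sum₂ (λ a b → k₁ (⊣ a) (⊣ b) *ₗ t₁ (⊣ a) (⊣ b)) ≈ᴹ ⊣⊢₂ +ᴹ ⊣⊣₂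
        leftBlocks = begin
          sum₂ (λ a b → k₁ (⊣ a) (⊣ b) *ₗ t₁ (⊣ a) (⊣ b))
            ≈⟨ sum₂-cong (λ a b → *ₗ-congˡ (left a b)) ⟩
          sum₂ (λ a b → k₁ (⊣ a) (⊣ b) *ₗ fibreSum (λ a i → t₂ (⊣ a) (⊢ i)) (λ b i → t₂ (⊣ b) (⊣ i)) a b)
            ≈⟨ sum₂-fibreSum (λ a b → k₁ (⊣ a) (⊣ b)) (λ a i → t₂ (⊣ a) (⊢ i)) (λ b i → t₂ (⊣ b) (⊣ i)) ⟩
          sum₂ (λ a i → k₁ (⊣ a) (⊣ (a ↑ i)) *ₗ t₂ (⊣ a) (⊢ i)) +ᴹ
          sum₂ (λ b i → k₁ (⊣ (b ↑ i)) (⊣ b) *ₗ t₂ (⊣ b) (⊣ i))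
            ≈⟨ +ᴹ-cong (sum₂-cong λ a i → *ₗ-congʳ (k₁≈k₂ (⊣₂ a i))) (sum₂-cong λ b i → *ₗ-congʳ (k₁≈k₂ (⊣⊣ b i))) ⟩
          ⊣⊢₂ +ᴹ ⊣⊣₂ ∎
        middleBlocks : sum₂ (λ a b → k₁ (⊣ a) (⊢ b) *ₗ t₁ (⊣ a) (⊢ b)) ≈ᴹ ⊢⊣₂
        middleBlocks = begin
          sum₂ (λ a b → k₁ (⊣ a) (⊢ b) *ₗ t₁ (⊣ a) (⊢ b))
            ≈⟨ sum₂-cong (λ a b → *ₗ-cong (k₁≈k₂ (⊣⊢ a b)) (middle a b)) ⟩
          sum₂ (λ a b → k₂ (⊢ b) (⊣ a) *ₗ t₂ (⊢ b) (⊣ a))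
            ≈⟨ ∑-comm {γ} {γ} (λ a b → k₂ (⊢ b) (⊣ a) *ₗ t₂ (⊢ b) (⊣ a)) ⟩
          ⊢⊣₂ ∎
        rightBlocks : sum₂ (λ a b → k₁ (⊢ a) (⊣ b) *ₗ t₁ (⊢ a) (⊣ b)) +ᴹ
                      sum₂ (λ a b → k₁ (⊢ a) (⊢ b) *ₗ t₁ (⊢ a) (⊢ b)) ≈ᴹ ⊢⊢₂
        -- Here the lone tree of a class has the second shape, so the regrouping is used backwards.
        rightBlocks = begin
          sum₂ (λ a b → k₁ (⊢ a) (⊣ b) *ₗ t₁ (⊢ a) (⊣ b)) +ᴹ sum₂ (λ a b → k₁ (⊢ a) (⊢ b) *ₗ t₁ (⊢ a) (⊢ b))
            ≈⟨ +ᴹ-cong (sum₂-cong λ a i → *ₗ-congʳ (k₁≈k₂ (⊢₂ a i))) (sum₂-cong λ b i → *ₗ-congʳ (k₁≈k₂ (⊢⊢ b i))) ⟩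
          sum₂ (λ a i → k₂ (⊢ a) (⊢ (a ↑ i)) *ₗ t₁ (⊢ a) (⊣ i)) +ᴹ
          sum₂ (λ b i → k₂ (⊢ (b ↑ i)) (⊢ b) *ₗ t₁ (⊢ b) (⊢ i))
            ≈⟨ sum₂-fibreSum (λ a b → k₂ (⊢ a) (⊢ b)) (λ a i → t₁ (⊢ a) (⊣ i)) (λ b i → t₁ (⊢ b) (⊢ i)) ⟨
          sum₂ (λ a b → k₂ (⊢ a) (⊢ b) *ₗ fibreSum (λ a i → t₁ (⊢ a) (⊣ i)) (λ b i → t₁ (⊢ b) (⊢ i)) a b)
            ≈⟨ sum₂-cong (λ a b → *ₗ-congˡ (right a b)) ⟨
          ⊢⊢₂ ∎

  -- Compatibility of linear extension and list sums with sums over `Fin n`.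

  module _ {m ℓm b : Level} {B : Set b} (V : Space m ℓm) (φ : B → ∣ V ∣) where

    open Extension V using (extend)
    open LeftModule V
    private
      module SB = Sums (freeSpace B)
      module SV = Sums V

    extend-sum : ∀ {n} (F : Fin n → Combination B) → extend φ (SB.sum F) ≈ᴹ SV.sum (λ i → extend φ (F i))
    extend-sum {ℕ.zero} F = ≈ᴹ-refl
    extend-sum {suc n}  F = +ᴹ-congˡ (extend-sum (F ∘ suc))

    extend-[] : ∀ b x → extend φ (SB.[ b ] x) ≈ᴹ SV.[ b ] extend φ x
    extend-[] true  x = ≈ᴹ-refl
    extend-[] false x = ≈ᴹ-refl

    extend-fibreSum : ∀ {γ} (f g : Fin γ → Fin γ → Combination B) a b →
      extend φ (SB.fibreSum f g a b) ≈ᴹ SV.fibreSum (λ a i → extend φ (f a i)) (λ b i → extend φ (g b i)) a b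
    extend-fibreSum f g a b = +ᴹ-cong
      (≈ᴹ-trans (extend-sum (λ i → SB.[ does (a ↑ i ≟ b) ] f a i)) (SV.sum-cong-≋ λ i → extend-[] (does (a ↑ i ≟ b)) (f a i)))
      (≈ᴹ-trans (extend-sum (λ i → SB.[ does (b ↑ i ≟ a) ] g b i)) (SV.sum-cong-≋ λ i → extend-[] (does (b ↑ i ≟ a)) (g b i)))

  module _ {b : Level} {B : Set b} where

    open Sums (freeSpace B)

    -- The function `u` is arbitrary because the tail of `tabulate u` is `tabulate (u ∘ suc)`;
    -- `allFin` is the case of the identity.
    foldr-filter-tabulate : ∀ {n γ p} {P : Fin γ → Set p} (P? : Decidable P) (F : Fin γ → Combination B) (u : Fin n → Fin γ) →
      foldr (λ a x → F a ⊕ x) 𝟎 (filter P? (tabulate u)) ≋ sum (λ i → [ does (P? (u i)) ] F (u i))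
    foldr-filter-tabulate {ℕ.zero} P? F u = ≋-refl
    foldr-filter-tabulate {suc n}  P? F u with does (P? (u zero))
    ... | true  = ⊕-cong ≋-refl (foldr-filter-tabulate P? F (u ∘ suc))
    ... | false = ≋-trans (foldr-filter-tabulate P? F (u ∘ suc)) (≋-sym (⊕-identityˡ _))

    ∑[]≋sum : ∀ {γ} (d : Fin γ) (F : Fin γ → Combination B) → ∑[ d ] F ≋ sum (λ i → [ does (i ≤? d) ] F i)
    ∑[]≋sum d F = foldr-filter-tabulate (_≤? d) F id

    fibreSum-∑[] : ∀ {γ} (f g : Fin γ → Fin γ → Combination B) d →
                   ∑[ d ] (λ i → g d i ⊕ f d i) ≋ fibreSum f g d d
    fibreSum-∑[] f g d = ≋-trans (∑[]≋sum d (λ i → g d i ⊕ f d i)) (≋-sym (fibreSum-≡ f g d))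

  -- The annihilator of the relations of Dias.

  module DendrDual (γ : ℕ) where

    private
      F₃ : Space c (c ⊔ ℓ₁)
      F₃ = Free (DendrGenerator γ) ⦅ 3 ⦆
      module F = SpaceLemmas F₃
      module SF = Sums F₃
      module SK = Sums scalars
      module KV = SpaceLemmas scalars
      module EK = Extension scalars
      open SK using ([_]_)
      open Orthogonality (_≟ᴰ_ {γ}) using (treeForm; annihilator; form)
      open Relabelling (dual {γ}) using (relabel; relabel-cong; mapBasis; extend-relabel)
      open Evaluation γ using (Rule; ⊣⊢; ⊣₂; ⊢₂; ⊣⊣; ⊢⊢)

      D : Set
      D = DiasGenerator γ

    leftˡ leftʳ rightˡ rightʳ : Fin γ → Fin γ → ∣ F₃ ∣
    leftˡ  b i = ↼ b ∘₂ ↼ i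
    leftʳ  a i = ↼ a ∘₂ ⇀ i
    rightˡ a i = ⇀ a ∘₁ ↼ i
    rightʳ b i = ⇀ b ∘₁ ⇀ i

    -- The elements attached to the words 0ba, b0a and ab0. Signs follow the stated relators: trees
    -- of the first shape are positive, those of the second negative.
    left middle right : Fin γ → Fin γ → ∣ F₃ ∣
    left   a b = ↼ a ∘₁ ↼ b -ᶠ SF.fibreSum leftʳ leftˡ a b
    middle a b = ↼ a ∘₁ ⇀ b -ᶠ ⇀ b ∘₂ ↼ a
    right  a b = SF.fibreSum rightˡ rightʳ a b -ᶠ ⇀ a ∘₂ ⇀ b

    -- The relators of `DendrRelator` indexed by all pairs, so that orthogonality is checked without
    -- comparing `a` and `b`.
    data ClassRelator : Pred ∣ F₃ ∣ c where
      isLeft   : ∀ a b → ClassRelator (left a b)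
      isMiddle : ∀ a b → ClassRelator (middle a b)
      isRight  : ∀ a b → ClassRelator (right a b)

    private
      left-< : ∀ {a b} → a < b → ↼ a ∘₁ ↼ b -ᶠ ↼ a ∘₂ ⇀ b ≋ left a b
      left-< a<b = ⊕-cong ≋-refl (⊖-cong (≋-sym (SF.fibreSum-< leftʳ leftˡ a<b)))
      left-> : ∀ {a b} → a < b → ↼ b ∘₁ ↼ a -ᶠ ↼ a ∘₂ ↼ b ≋ left b a
      left-> a<b = ⊕-cong ≋-refl (⊖-cong (≋-sym (SF.fibreSum-> leftʳ leftˡ a<b)))
      left-≡ : ∀ d → ↼ d ∘₁ ↼ d -ᶠ ∑[ d ] (λ a → ↼ d ∘₂ ↼ a ⊕ ↼ d ∘₂ ⇀ a) ≋ left d d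
      left-≡ d = ⊕-cong ≋-refl (⊖-cong (fibreSum-∑[] leftʳ leftˡ d))
      right-< : ∀ {a b} → a < b → ⇀ a ∘₁ ↼ b -ᶠ ⇀ a ∘₂ ⇀ b ≋ right a b
      right-< a<b = ⊕-cong (≋-sym (SF.fibreSum-< rightˡ rightʳ a<b)) ≋-refl
      right-> : ∀ {a b} → a < b → ⇀ a ∘₁ ⇀ b -ᶠ ⇀ b ∘₂ ⇀ a ≋ right b a
      right-> a<b = ⊕-cong (≋-sym (SF.fibreSum-> rightˡ rightʳ a<b)) ≋-refl
      right-≡ : ∀ d → ∑[ d ] (λ a → ⇀ d ∘₁ ⇀ a ⊕ ⇀ d ∘₁ ↼ a) -ᶠ ⇀ d ∘₂ ⇀ d ≋ right d d
      right-≡ d = ⊕-cong (fibreSum-∑[] rightˡ rightʳ d) ≋-refl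

    classRelator : ∀ {x} → DendrRelator γ x → Σ ∣ F₃ ∣ λ y → ClassRelator y × x ≋ y
    classRelator (↼⇀ a a′)    = _ , isMiddle a a′ , ≋-refl
    classRelator (↼<₁ a b lt) = _ , isLeft a b    , left-< lt
    classRelator (⇀<₁ a b lt) = _ , isRight a b   , right-< lt
    classRelator (↼<₂ a b lt) = _ , isLeft b a    , left-> lt
    classRelator (⇀<₂ a b lt) = _ , isRight b a   , right-> lt
    classRelator (↼∑ d)       = _ , isLeft d d    , left-≡ d
    classRelator (⇀∑ d)       = _ , isRight d d   , right-≡ d

    left∈ : ∀ a b → left a b ∈ DendrRelations γ
    left∈ a b with Fin.<-cmp a b
    ... | tri< a<b _ _    = ≈-in (left-< a<b) (member (↼<₁ a b a<b))
    ... | tri≈ _ refl _   = ≈-in (left-≡ a) (member (↼∑ a))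
    ... | tri> _ _ b<a    = ≈-in (left-> b<a) (member (↼<₂ b a b<a))

    right∈ : ∀ a b → right a b ∈ DendrRelations γ
    right∈ a b with Fin.<-cmp a b
    ... | tri< a<b _ _    = ≈-in (right-< a<b) (member (⇀<₁ a b a<b))
    ... | tri≈ _ refl _   = ≈-in (right-≡ a) (member (⇀∑ a))
    ... | tri> _ _ b<a    = ≈-in (right-> b<a) (member (⇀<₂ b a b<a))

    -- The functional pairing `s` with the relabelling of its argument.
    coefficient : Tree D → ∣ F₃ ∣ → K.Carrier
    coefficient s = EK.extend λ t → treeForm s (proj₁ (mapBasis t))

    private
      t₁ t₂ : D → D → Tree D
      t₁ x y = node x (node y leaf leaf) leaf
      t₂ x y = node x leaf (node y leaf leaf)

    -- The form is negative on trees of the second shape, so coefficient₂ is minus the actual coefficient.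
    coefficient₁ coefficient₂ : D → D → ∣ F₃ ∣ → K.Carrier
    coefficient₁ x y = coefficient (t₁ x y)
    coefficient₂ x y = coefficient (t₂ x y)

    -- Orthogonality to the relator of a rule thus means equality of two coefficients. Linearity in
    -- the first argument is by computation; only the relabelling needs an argument.
    form-relator : ∀ x y x′ y′ z →
      form (x ∘₁ y -ᶠ x′ ∘₂ y′) (relabel z) K.≈ coefficient₁ x y z K.- coefficient₂ x′ y′ z
    form-relator x y x′ y′ z = K.+-cong (extend-relabel scalars _ z) (K.-‿cong (extend-relabel scalars _ z))

    private
      left-coefficient : ∀ s {a b u f g} →
        coefficient s (↼ a ∘₁ ↼ b) K.≈ u →
        (∀ a i → coefficient s (↼ a ∘₂ ⇀ i) K.≈ f a i) → (∀ b i → coefficient s (↼ b ∘₂ ↼ i) K.≈ g b i) →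
        coefficient s (left a b) K.≈ u K.- SK.fibreSum f g a b
      left-coefficient s {a} {b} p q r = K.+-cong p (K.-‿cong
        (K.trans (extend-fibreSum scalars _ leftʳ leftˡ a b) (SK.fibreSum-cong q r a b)))

      right-coefficient : ∀ s {a b u f g} →
        coefficient s (⇀ a ∘₂ ⇀ b) K.≈ u →
        (∀ a i → coefficient s (⇀ a ∘₁ ↼ i) K.≈ f a i) → (∀ b i → coefficient s (⇀ b ∘₁ ⇀ i) K.≈ g b i) →
        coefficient s (right a b) K.≈ SK.fibreSum f g a b K.- u
      right-coefficient s {a} {b} p q r = K.+-cong
        (K.trans (extend-fibreSum scalars _ rightˡ rightʳ a b) (SK.fibreSum-cong q r a b))
        (K.-‿cong p)

      x-0≈x : ∀ {x y} → y K.≈ K.0# → x K.- y K.≈ x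
      x-0≈x {x} p = K.trans (K.+-congˡ (K.trans (K.-‿cong p) KV.ε⁻¹≈ε)) (K.+-identityʳ x)

      -- The sign of the form on the second shape cancels the minus sign in a class relator.
      0-[-1] : ∀ b {y} → y K.≈ [ b ] (K.- K.1#) → K.0# K.- y K.≈ [ b ] K.1#
      0-[-1] true  p = K.trans (K.+-identityˡ _) (K.trans (K.-‿cong p) (KV.⁻¹-involutive K.1#))
      0-[-1] false p = x-0≈x p

      -- For inner labels of different kinds the second decision computes to `false`, but the
      -- conjunction is stuck on the first.
      [∧false] : ∀ b {x} → (if b ∧ false then x else K.0#) K.≈ K.0#
      [∧false] true  = K.refl
      [∧false] false = K.refl

      -- Stands for a family of values of the form that compute to 0, as when shapes or root kinds
      -- differ.
      0≈ : ∀ {A B : Set} → A → B → K.0# K.≈ K.0#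
      0≈ _ _ = K.refl

      left-zero : ∀ s {a b} → coefficient s (↼ a ∘₁ ↼ b) K.≈ K.0# →
        (∀ a i → coefficient s (↼ a ∘₂ ⇀ i) K.≈ K.0#) → (∀ b i → coefficient s (↼ b ∘₂ ↼ i) K.≈ K.0#) →
        coefficient s (left a b) K.≈ K.0#
      left-zero s {a} {b} p q r = K.trans (left-coefficient s p q r) (x-0≈x (SK.fibreSum-zero 0≈ 0≈ a b))

      right-zero : ∀ s {a b} → coefficient s (⇀ a ∘₂ ⇀ b) K.≈ K.0# →
        (∀ a i → coefficient s (⇀ a ∘₁ ↼ i) K.≈ K.0#) → (∀ b i → coefficient s (⇀ b ∘₁ ⇀ i) K.≈ K.0#) →
        coefficient s (right a b) K.≈ K.0#
      right-zero s {a} {b} p q r = K.trans (right-coefficient s p q r)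
        (K.trans (x-0≈x K.refl) (SK.fibreSum-zero 0≈ 0≈ a b))

    -- The common value is 1 if the two trees of the rule lie in the class of `z` and 0 otherwise.
    -- It can be nonzero only for `⊣₂` and `⊣⊣` against `isLeft`, `⊣⊢` against `isMiddle`, `⊢₂` and
    -- `⊢⊢` against `isRight`.
    balanced : ∀ {x y x′ y′} → Rule x y x′ y′ → ∀ {z} → ClassRelator z → coefficient₁ x y z K.≈ coefficient₂ x′ y′ z
    balanced (⊣⊢ a′ b′) (isLeft a b) = K.trans
      (left-zero (t₁ (⊣ a′) (⊢ b′)) ([∧false] (does (a′ ≟ a))) 0≈ 0≈)
      (K.sym (left-zero (t₂ (⊢ b′) (⊣ a′)) K.refl 0≈ 0≈))
    balanced (⊣₂ a′ b′) (isLeft a b) = K.trans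
      (K.trans (left-coefficient (t₁ (⊣ a′) (⊣ (a′ ↑ b′))) K.refl 0≈ 0≈) (x-0≈x (SK.fibreSum-zero 0≈ 0≈ a b)))
      (K.sym (K.trans
        (left-coefficient (t₂ (⊣ a′) (⊢ b′)) K.refl (λ _ _ → K.refl) (λ b i → [∧false] (does (a′ ≟ b))))
        (0-[-1] _ (SK.fibreSum-δˡ a′ b′ (K.- K.1#) a b))))
    balanced (⊢₂ a′ b′) (isLeft a b) = K.trans
      (left-zero (t₁ (⊢ a′) (⊣ b′)) K.refl 0≈ 0≈)
      (K.sym (left-zero (t₂ (⊢ a′) (⊢ (a′ ↑ b′))) K.refl 0≈ 0≈))
    balanced (⊣⊣ a′ b′) (isLeft a b) = K.trans
      (K.trans (left-coefficient (t₁ (⊣ (a′ ↑ b′)) (⊣ a′)) K.refl 0≈ 0≈) (x-0≈x (SK.fibreSum-zero 0≈ 0≈ a b)))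
      (K.sym (K.trans
        (left-coefficient (t₂ (⊣ a′) (⊣ b′)) K.refl (λ a i → [∧false] (does (a′ ≟ a))) (λ _ _ → K.refl))
        (0-[-1] _ (SK.fibreSum-δʳ a′ b′ (K.- K.1#) a b))))
    balanced (⊢⊢ a′ b′) (isLeft a b) = K.trans
      (left-zero (t₁ (⊢ a′) (⊢ b′)) K.refl 0≈ 0≈)
      (K.sym (left-zero (t₂ (⊢ (a′ ↑ b′)) (⊢ a′)) K.refl 0≈ 0≈))
    balanced (⊣⊢ a′ b′) (isMiddle a b) = K.trans
      (x-0≈x K.refl)
      -- The two trees of this rule carry their labels in opposite order, hence the swapped
      -- conjunction.
      (K.trans (SK.[]-congᵇ K.1# (∧-comm (does (a′ ≟ a)) (does (b′ ≟ b)))) (K.sym (0-[-1] (does (b′ ≟ b) ∧ does (a′ ≟ a)) K.refl)))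
    balanced (⊣₂ a′ b′) (isMiddle a b) = K.+-congʳ ([∧false] (does (a′ ≟ a)))
    balanced (⊢₂ a′ b′) (isMiddle a b) = K.+-congˡ (K.-‿cong (K.sym ([∧false] (does (a′ ≟ b)))))
    balanced (⊣⊣ a′ b′) (isMiddle a b) = K.+-congʳ ([∧false] (does (a′ ↑ b′ ≟ a)))
    balanced (⊢⊢ a′ b′) (isMiddle a b) = K.+-congˡ (K.-‿cong (K.sym ([∧false] (does (a′ ↑ b′ ≟ b)))))
    balanced (⊣⊢ a′ b′) (isRight a b) = K.trans
      (right-zero (t₁ (⊣ a′) (⊢ b′)) K.refl 0≈ 0≈)
      (K.sym (right-zero (t₂ (⊢ b′) (⊣ a′)) ([∧false] (does (b′ ≟ a))) 0≈ 0≈))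
    balanced (⊣₂ a′ b′) (isRight a b) = K.trans
      (right-zero (t₁ (⊣ a′) (⊣ (a′ ↑ b′))) K.refl 0≈ 0≈)
      (K.sym (right-zero (t₂ (⊣ a′) (⊢ b′)) K.refl 0≈ 0≈))
    balanced (⊢₂ a′ b′) (isRight a b) = K.trans
      (K.trans (right-coefficient (t₁ (⊢ a′) (⊣ b′)) K.refl (λ _ _ → K.refl) (λ b i → [∧false] (does (a′ ≟ b))))
        (K.trans (x-0≈x K.refl) (SK.fibreSum-δˡ a′ b′ K.1# a b)))
      (K.sym (K.trans (right-coefficient (t₂ (⊢ a′) (⊢ (a′ ↑ b′))) K.refl 0≈ 0≈)
        (K.trans (K.+-congʳ (SK.fibreSum-zero 0≈ 0≈ a b)) (0-[-1] (does (a′ ≟ a) ∧ does (a′ ↑ b′ ≟ b)) K.refl))))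
    balanced (⊣⊣ a′ b′) (isRight a b) = K.trans
      (right-zero (t₁ (⊣ (a′ ↑ b′)) (⊣ a′)) K.refl 0≈ 0≈)
      (K.sym (right-zero (t₂ (⊣ a′) (⊣ b′)) K.refl 0≈ 0≈))
    balanced (⊢⊢ a′ b′) (isRight a b) = K.trans
      (K.trans (right-coefficient (t₁ (⊢ a′) (⊢ b′)) K.refl (λ a i → [∧false] (does (a′ ≟ a))) (λ _ _ → K.refl))
        (K.trans (x-0≈x K.refl) (SK.fibreSum-δʳ a′ b′ K.1# a b)))
      (K.sym (K.trans (right-coefficient (t₂ (⊢ (a′ ↑ b′)) (⊢ a′)) K.refl 0≈ 0≈)
        (K.trans (K.+-congʳ (SK.fibreSum-zero 0≈ 0≈ a b)) (0-[-1] (does (a′ ↑ b′ ≟ a) ∧ does (a′ ≟ b)) K.refl))))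

    private
      relators-orthogonal : ∀ {r} → DiasRelator γ r → ∀ {z} → ClassRelator z → form r (relabel z) K.≈ K.0#
      relators-orthogonal r {z} z∈ = go r
        where
        vanishes : ∀ {x y x′ y′} → Rule x y x′ y′ → form (x ∘₁ y -ᶠ x′ ∘₂ y′) (relabel z) K.≈ K.0#
        vanishes {x} {y} {x′} {y′} ρ = K.trans (form-relator x y x′ y′ z) (KV.x≈y⇒x∙y⁻¹≈ε (balanced ρ z∈))
        go : ∀ {r} → DiasRelator γ r → form r (relabel z) K.≈ K.0#
        go (⊣⊢ a b) = vanishes (⊣⊢ a b)
        go (⊣₂ a b) = vanishes (⊣₂ a b)
        go (⊢₂ a b) = vanishes (⊢₂ a b)
        go (⊣⊣ a b) = vanishes (⊣⊣ a b)
        go (⊢⊢ a b) = vanishes (⊢⊢ a b)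

      form-zero : ∀ y → (∀ {r} → DiasRelator γ r → form r y K.≈ K.0#) → ∀ x → x ∈ DiasRelations γ → form x y K.≈ K.0#
      form-zero y p _ = go
        where
        go : ∀ {x} → Spanned {V = Free D ⦅ 3 ⦆} (DiasRelator γ) x → form x y K.≈ K.0#
        go (member r)     = p r
        go (≈-in x≈x′ q)  = K.trans (EK.extend₂-cong _ {y = y} (≋-sym x≈x′) ≋-refl) (go q)
        go 0-in           = K.refl
        go (+-in q q′)    = K.trans (K.+-cong (go q) (go q′)) (K.+-identityˡ K.0#)
        go (*-in k q)     = K.trans (K.*-congˡ (go q)) (K.zeroʳ k)

      Ann : QuadraticSpace D (c ⊔ ℓ₁)
      Ann = annihilator (DiasRelations γ)

    -- By linearity it suffices to pair class relators with relators of Dias, where `balanced`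
    -- applies.
    relations⊆annihilator : ∀ z → z ∈ DendrRelations γ → relabel z ∈ annihilator (DiasRelations γ)
    relations⊆annihilator _ = go
      where
      open Subspace Ann
      go : ∀ {z} → Spanned {V = F₃} (DendrRelator γ) z → relabel z ∈ Ann
      go (member r) with classRelator r
      ... | y , y∈ , z≋y = resp (relabel-cong (≋-sym z≋y)) (form-zero (relabel y) λ r′ → relators-orthogonal r′ y∈)
      go (≈-in z≋z′ q) = resp (relabel-cong z≋z′) (go q)
      go 0-in          = 0-closed
      go (+-in {x} {y} q q′) = +-closed {relabel x} {relabel y} (go q) (go q′)
      go (*-in k {x} q) = *-closed k {relabel x} (go q)

    private
      -- Trees over `DendrGenerator`, indexed by Dias labels because `combination` sums over these.
      u₁ u₂ : D → D → ∣ F₃ ∣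
      u₁ x y = dual⁻¹ x ∘₁ dual⁻¹ y
      u₂ x y = dual⁻¹ x ∘₂ dual⁻¹ y

    -- The second combination is subtracted because `coefficient₂` is minus the actual coefficient.
    expansion : ∀ z → z ≋ SF.combination (λ x y → coefficient₁ x y z) u₁ -ᶠ SF.combination (λ x y → coefficient₂ x y z) u₂
    expansion ⟨ t , p ⟩ with quadratic t p
    ... | inner₁ x y = ≋-sym (≋-trans
      (⊕-cong (≋-trans (SF.combination-≟ (dual x) (dual y) K.1# u₁) (⊙-identityˡ _))
              (≋-trans (⊖-cong (SF.combination-zero u₂ 0≈)) F.ε⁻¹≈ε))
      (≋-trans (F.+ᴹ-identityʳ _)
        (Linearisation.lift (Trees.setOperad (DendrGenerator γ))
          (cong₂ (λ x y → node x (node y leaf leaf) leaf) (dual⁻¹-dual x) (dual⁻¹-dual y)))))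
    ... | inner₂ x y = ≋-sym (≋-trans
      (⊕-cong (SF.combination-zero u₁ 0≈)
              -- The form gives -1 on a tree of the second shape, which the outer minus sign undoes.
              (⊖-cong (≋-trans (SF.combination-≟ (dual x) (dual y) (K.- K.1#) u₂) (≋-sym (F.neg≈-1* _)))))
      (≋-trans (F.+ᴹ-identityˡ _) (≋-trans (F.⁻¹-involutive _)
        (Linearisation.lift (Trees.setOperad (DendrGenerator γ))
          (cong₂ (λ x y → node x leaf (node y leaf leaf)) (dual⁻¹-dual x) (dual⁻¹-dual y))))))
    expansion 𝟎 = ≋-sym (≋-trans (⊕-cong (SF.combination-zero u₁ 0≈) (⊖-cong (SF.combination-zero u₂ 0≈)))
                                 (F.-ᴹ‿inverseʳ 𝟎))
    expansion (z ⊕ w) = ≋-trans (⊕-cong (expansion z) (expansion w)) (≋-trans (≋-sym (F.-‿+ _ _ _ _))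
      (≋-sym (⊕-cong (SF.combination-+ (λ x y → coefficient₁ x y z) (λ x y → coefficient₁ x y w) u₁)
                     (⊖-cong (SF.combination-+ (λ x y → coefficient₂ x y z) (λ x y → coefficient₂ x y w) u₂)))))
    expansion (⊖ z) = ≋-trans (⊖-cong (expansion z)) (≋-trans (≋-sym (F.⁻¹-∙-comm _ _))
      (≋-sym (⊕-cong (SF.combination-neg (λ x y → coefficient₁ x y z) u₁)
                     (⊖-cong (SF.combination-neg (λ x y → coefficient₂ x y z) u₂)))))
    expansion (k ⊙ z) = ≋-trans (⊙-cong K.refl (expansion z)) (≋-trans (⊙-distribˡ k _ _)
      (≋-trans (⊕-cong ≋-refl (F.*ₗ-neg k _))
      (≋-sym (⊕-cong (SF.combination-* k (λ x y → coefficient₁ x y z) u₁)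
                     (⊖-cong (SF.combination-* k (λ x y → coefficient₂ x y z) u₂))))))

    -- In the quotient by `DendrRelations` the two combinations of `expansion` coincide; the
    -- agreement of coefficients this requires is orthogonality to the relators of Dias.
    annihilator⊆relations : ∀ z → relabel z ∈ annihilator (DiasRelations γ) → z ∈ DendrRelations γ
    annihilator⊆relations z p = ≈-in (≋-sym (expansion z))
      -- Equality in the quotient space unfolds to membership of the difference, here the right side
      -- of `expansion`.
      (SQ.combination-balance (λ x y → coefficient₁ x y z) (λ x y → coefficient₂ x y z) u₁ u₂
        left∈ (λ a b → member (↼⇀ a b)) (λ a b → Q.≈ᴹ-sym (right∈ a b)) equal)
      where
      module Q = LeftModule (quotientSpace F₃ (DendrRelations γ))
      module SQ = Sums (quotientSpace F₃ (DendrRelations γ))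
      equal : ∀ {x y x′ y′} → Rule x y x′ y′ → coefficient₁ x y z K.≈ coefficient₂ x′ y′ z
      equal {x} {y} {x′} {y′} ρ = KV.x∙y⁻¹≈ε⇒x≈y _ _
        (K.trans (K.sym (form-relator x y x′ y′ z)) (p _ (member (DiasPresentation.rule-relator γ ρ))))

theorem4p1p1 : ∀ {c ℓ₁ ℓ₂ : Level} (K : HeytingField c ℓ₁ ℓ₂) → CharacteristicZero K →
    (γ : ℕ) → Over.IsPresentedBy K (Over.Dendr K γ) (DendrGenerator γ) (Over.DendrRelations K γ)
theorem4p1p1 K _ γ = relabel-isomorphism K dual dual⁻¹ dual⁻¹-dual dual-dual⁻¹
  (DendrDual.relations⊆annihilator K γ) (DendrDual.annihilator⊆relations K γ)
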